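{- Let $G$ be a semi-balanced digraph, let $\mathcal{T}$ be any dissecting tree set for $G$, and fix any total ordering of the edges of $G$. Then for every $i$, the coefficient of $x^i$ in the $h^*$-polynomial of the root polytope $\mathcal{Q}_G$ equals $$|\{T\in \mathcal{T}\mid T \text{ has exactly } i \text{ internally semi-passive edges}\}|.$$
   Context: A digraph $G$ is semi-balanced if every cycle (of the underlying undirected graph) has the same number of edges oriented in each of the two cyclic directions. For a vertex $u$, $\mathbf{1}_u$ is the standard basis vector of $\mathbb{R}^{V(G)}$. For a digraph $D$, the root polytope is $\mathcal{Q}_D=\mathrm{conv}\{\mathbf{1}_h-\mathbf{1}_t \mid \overrightarrow{th}\in E(D)\}$. A dissecting tree set for $G$ is a set $\mathcal{T}$ of spanning trees of $G$ such that the simplices $\mathcal{Q}_T$, $T\in\mathcal{T}$, have pairwise disjoint relative interiors and their union is $\mathcal{Q}_G$. For a spanning tree $T$ and $e\in T$, the fundamental cut $C^*(T,e)$ is the set of edges of $G$ joining the two components (shores) of $T-e$; an edge $e'\in C^*(T,e)$ stands parallel to $e$ if the heads of $e$ and $e'$ lie in the same shore, and opposite otherwise. Given a total order on $E(G)$, an edge $e\in T$ is internally semi-passive for $T$ if the maximal edge of $C^*(T,e)$ stands opposite to $e$. For a $d$-dimensional lattice polytope $P\subset\mathbb{R}^n$ with Ehrhart polynomial $\varepsilon_P(t)=|tP\cap\mathbb{Z}^n|$, writing uniquely $\varepsilon_P(t)=\sum_{k=0}^d a_k\binom{t+d-k}{d}$, the $h^*$-polynomial of $P$ is $\sum_{k=0}^d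 a_k x^k$. -}

module Defs where

open import Data.Nat as ℕ using (ℕ; zero; suc; _∸_)
open import Data.Nat.Combinatorics using (_C_)
open import Data.Integer as ℤ using (ℤ)
open import Data.Rational as ℚ using (ℚ; 0ℚ; 1ℚ)
open import Data.Fin as Fin using (Fin; zero; suc; inject₁; fromℕ)
open import Data.Vec using (Vec; lookup)
open import Data.Bool using (Bool; true; false; not; if_then_else_)
open import Data.Product using (Σ; Σ-syntax; ∃; ∃-syntax; _×_; _,_; proj₁; proj₂)
open import Data.Empty using (⊥)
open import Relation.Nullary using (¬_; Dec; yes; no)
open import Relation.Binary.PropositionalEquality using (_≡_; _≢_)
open import Function.Bundles using (_⇔_)

sumℕ : ∀ {k} → (Fin k → ℕ) → ℕ
sumℕ {zero}  f = 0
sumℕ {suc k} f = f zero ℕ.+ sumℕ (λ i → f (suc i))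

sumℚ : ∀ {k} → (Fin k → ℚ) → ℚ
sumℚ {zero}  f = 0ℚ
sumℚ {suc k} f = f zero ℚ.+ sumℚ (λ i → f (suc i))

countTrue : ∀ {k} → (Fin k → Bool) → ℕ
countTrue {zero}  f = 0
countTrue {suc k} f = (if f zero then 1 else 0) ℕ.+ countTrue (λ i → f (suc i))

CountIs : {A : Set} → (A → Set) → ℕ → Set
CountIs {A} P N =
  Σ[ f ∈ (Fin N → A) ] ((∀ i j → f i ≡ f j → i ≡ j) × (∀ x → P x ⇔ (∃[ i ] f i ≡ x)))

-- Digraphs: n vertices Fin n, m edges Fin m, edge e ↦ (tail , head).
-- Loops and multiple edges are allowed.

record Digraph : Set where
  field
    n    : ℕ
    m    : ℕ
    edge : Fin m → Fin n × Fin n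

module _ (G : Digraph) where
  open Digraph G

  tl hd : Fin m → Fin n
  tl e = proj₁ (edge e)
  hd e = proj₂ (edge e)

  record CycleIn (S : Fin m → Set) : Set where
    field
      len     : ℕ
      len≥1   : 1 ℕ.≤ len
      vs      : Fin (suc len) → Fin n
      es      : Fin len → Fin m
      fw      : Fin len → Bool
      closed  : vs (fromℕ len) ≡ vs zero
      vs-inj  : ∀ i j → vs (inject₁ i) ≡ vs (inject₁ j) → i ≡ j
      es-inj  : ∀ i j → es i ≡ es j → i ≡ j
      es-in   : ∀ i → S (es i)
      step    : ∀ i → edge (es i) ≡
                  (if fw i then (vs (inject₁ i) , vs (suc i))
                           else (vs (suc i) , vs (inject₁ i)))

  Cycle : Set
  Cycle = CycleIn (λ _ → Data.Unit.⊤)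
    where import Data.Unit

  SemiBalanced : Set
  SemiBalanced = (cyc : Cycle) →
    countTrue (CycleIn.fw cyc) ≡ countTrue (λ i → not (CycleIn.fw cyc i))

  data Reach (S : Fin m → Set) (u : Fin n) : Fin n → Set where
    here : Reach S u u
    fwd  : ∀ e → S e → Reach S u (tl e) → Reach S u (hd e)
    bwd  : ∀ e → S e → Reach S u (hd e) → Reach S u (tl e)

  _∈E_ : Fin m → (Fin m → Bool) → Set
  e ∈E T = T e ≡ true

  IsSpanningTree : (Fin m → Bool) → Set
  IsSpanningTree T =
    (∀ u v → Reach (_∈E T) u v) × ¬ CycleIn (_∈E T)

  minus : (Fin m → Bool) → Fin m → (Fin m → Set)
  minus T e e′ = (e′ ∈E T) × (e′ ≢ e)

  InHeadShore : (Fin m → Bool) → Fin m → Fin n → Set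
  InHeadShore T e v = Reach (minus T e) v (hd e)

  CutOpposite : (Fin m → Bool) → Fin m → Fin m → Set
  CutOpposite T e e′ = InHeadShore T e (tl e′) × ¬ InHeadShore T e (hd e′)

  InCut : (Fin m → Bool) → Fin m → Fin m → Set
  InCut T e e′ =
    (InHeadShore T e (tl e′) × ¬ InHeadShore T e (hd e′)) Data.Sum.⊎
    (InHeadShore T e (hd e′) × ¬ InHeadShore T e (tl e′))
    where import Data.Sum

  -- total order on edges given by an injective rank
  -- e is internally semi-passive for T: e ∈ T and the maximal edge of C*(T,e)
  -- stands opposite to e
  InternallySemiPassive : (rank : Fin m → ℕ) → (Fin m → Bool) → Fin m → Set
  InternallySemiPassive rank T e =
    (e ∈E T) ×
    (Σ[ e′ ∈ Fin m ] (CutOpposite T e e′ × (∀ e″ → InCut T e e″ → rank e″ ℕ.≤ rank e′)))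

  indicator : Fin n → Fin n → ℚ
  indicator u v with u Fin.≟ v
  ... | yes _ = 1ℚ
  ... | no  _ = 0ℚ

  rootVec : Fin m → Fin n → ℚ
  rootVec e v = indicator (hd e) v ℚ.- indicator (tl e) v

  combo : (Fin m → ℚ) → Fin n → ℚ
  combo λ′ v = sumℚ (λ e → λ′ e ℚ.* rootVec e v)

  InRootPolytope : (Fin m → Set) → (Fin n → ℚ) → Set
  InRootPolytope S x = Σ[ c ∈ (Fin m → ℚ) ]
    ((∀ e → 0ℚ ℚ.≤ c e) × (∀ e → ¬ S e → c e ≡ 0ℚ) ×
     (sumℚ c ≡ 1ℚ) × (∀ v → x v ≡ combo c v))

  InRelInt : (Fin m → Set) → (Fin n → ℚ) → Set
  InRelInt S x = Σ[ c ∈ (Fin m → ℚ) ]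
    ((∀ e → S e → 0ℚ ℚ.< c e) × (∀ e → ¬ S e → c e ≡ 0ℚ) ×
     (sumℚ c ≡ 1ℚ) × (∀ v → x v ≡ combo c v))

  allEdges : Fin m → Set
  allEdges _ = Data.Unit.⊤
    where import Data.Unit

  IsDissectingTreeSet : ∀ {k} → (Fin k → (Fin m → Bool)) → Set
  IsDissectingTreeSet {k} 𝒯 =
    (∀ j → IsSpanningTree (𝒯 j)) ×
    (∀ i j → i ≢ j → ∀ x → InRelInt (_∈E 𝒯 i) x → ¬ InRelInt (_∈E 𝒯 j) x) ×
    (∀ x → InRootPolytope allEdges x ⇔ (∃[ j ] InRootPolytope (_∈E 𝒯 j) x))

  InDilate : ℕ → Vec ℤ n → Set
  InDilate t p = Σ[ c ∈ (Fin m → ℚ) ]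
    ((∀ e → 0ℚ ℚ.≤ c e) × (sumℚ c ≡ (ℤ.+ t) ℚ./ 1) ×
     (∀ v → (lookup p v) ℚ./ 1 ≡ combo c v))

  AffinelyIndependent : ∀ {k} → (Fin k → Fin m) → Set
  AffinelyIndependent {k} f = (μ : Fin k → ℚ) → sumℚ μ ≡ 0ℚ →
    (∀ v → sumℚ (λ i → μ i ℚ.* rootVec (f i) v) ≡ 0ℚ) → ∀ i → μ i ≡ 0ℚ

  HasDim : ℕ → Set
  HasDim d = (Σ[ f ∈ (Fin (suc d) → Fin m) ] AffinelyIndependent f) ×
             ((f : Fin (suc (suc d)) → Fin m) → ¬ AffinelyIndependent f)

  IsHStar : ℕ → (ℕ → ℕ) → Set
  IsHStar d h =
    (∀ k → d ℕ.< k → h k ≡ 0) ×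
    (∀ t → 1 ℕ.≤ t → CountIs (InDilate t)
       (sumℕ {suc d} (λ k → h (Fin.toℕ k) ℕ.* ((t ℕ.+ d ∸ Fin.toℕ k) C d))))

{-# OPTIONS --safe #-}
module Submission where

{- Give the edge of rank r the weight B^r with B = m + 1, and let q be the weighted sum of all root vectors. The
coordinate of q at an edge e of a spanning tree T is the sum of the weights over the fundamental cut C*(T,e), with sign
+ for parallel and − for opposite edges. The heaviest edge of the cut dominates, so the coordinate is nonzero, and it is
negative exactly when e is internally semi-passive. Thus q is in general position with respect to all the cones over the
simplices Q_T, and moving a lattice point x of tQ_G slightly towards q puts it in the interior of exactly one of them.
The tree coordinates of x are integers, so this happens exactly when they are nonnegative, and at least 1 at the
semi-passive edges. For a tree with i such edges there are C(t + d − i, d) points of this kind. No limit is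
needed: M x + q, with M larger than every coordinate of q, is close enough to the ray of x.

Semi-balancedness makes the coordinates of a point of tQ_G in any tree sum to t, via fundamental cycles. -}

open import Defs
open import Algebra.Properties.CommutativeSemigroup using (interchange)
open import Algebra.Properties.Group using (∙-cancelʳ)
open import Data.Bool using (Bool; true; false; not; if_then_else_)
import Data.Bool.Properties as Boolₚ
open import Data.Empty using (⊥; ⊥-elim)
open import Data.Fin as Fin using (Fin; zero; suc; inject₁; punchIn; punchOut; splitAt; toℕ; _↑ˡ_; _↑ʳ_)
import Data.Fin.Properties as Finₚ
open import Data.Integer as ℤ using (ℤ)
import Data.Integer.Properties as ℤₚ
open import Data.Nat as ℕ using (ℕ; zero; suc; z≤n; s≤s; _∸_)
open import Data.Nat.Combinatorics using (_C_; nCk+nC[k+1]≡[n+1]C[k+1]; nCn≡1; k>n⇒nCk≡0)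
import Data.Nat.Coprimality as Coprimality
import Data.Nat.Properties as ℕₚ
open import Data.Product using (Σ-syntax; ∃-syntax; _×_; _,_; proj₁; proj₂)
open import Data.Rational as ℚ using (ℚ; mkℚ; 0ℚ; 1ℚ; _+_; _*_; _-_; -_)
import Data.Rational.Properties as ℚₚ
open import Data.Rational.Solver using (module +-*-Solver)
open import Data.Sum as Sum using (_⊎_; inj₁; inj₂; [_,_]′)
open import Data.Unit using (⊤; tt)
open import Data.Vec as Vec using (Vec; []; _∷_; lookup; tabulate)
import Data.Vec.Properties as Vecₚ
open import Function using (_∘_)
open import Function.Bundles using (_⇔_; mk⇔; Equivalence)
open import Relation.Binary.PropositionalEquality
open import Relation.Nullary using (¬_; Dec; yes; no; does)
open import Relation.Nullary.Decidable using (_×-dec_; map′; ¬?; decidable-stable; dec-true; dec-false)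
open Equivalence using (to; from)
open +-*-Solver using (solve; _:=_; _:+_; _:*_; _:-_; :-_; con)

-- Counting

module _ {A : Set} where

  CountIs-⇔ : ∀ {P Q : A → Set} {N} → (∀ x → P x ⇔ Q x) → CountIs P N → CountIs Q N
  CountIs-⇔ eq (f , inj , sur) =
    f , inj , λ x → mk⇔ (λ q → to (sur x) (from (eq x) q)) (λ e → to (eq x) (from (sur x) e))

  CountIs-≤ : ∀ {P Q : A → Set} {M N} → (∀ x → P x → Q x) → CountIs P M → CountIs Q N → M ℕ.≤ N
  CountIs-≤ {M = M} {N} imp (f , finj , fsur) (g , ginj , gsur) = Finₚ.injective⇒≤ {f = h} h-inj
    where
    pre : ∀ i → ∃[ j ] g j ≡ f i
    pre i = to (gsur (f i)) (imp _ (from (fsur (f i)) (i , refl)))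
    h : Fin M → Fin N
    h i = proj₁ (pre i)
    h-inj : ∀ {i j} → h i ≡ h j → i ≡ j
    h-inj {i} {j} eq = finj i j (trans (sym (proj₂ (pre i))) (trans (cong g eq) (proj₂ (pre j))))

  CountIs-unique : ∀ {P : A → Set} {M N} → CountIs P M → CountIs P N → M ≡ N
  CountIs-unique c c′ = ℕₚ.≤-antisym (CountIs-≤ (λ _ p → p) c c′) (CountIs-≤ (λ _ p → p) c′ c)

  CountIs-empty : ∀ {P : A → Set} → (∀ x → ¬ P x) → CountIs P 0
  CountIs-empty np = (λ ()) , (λ ()) , λ x → mk⇔ (λ p → ⊥-elim (np x p)) (λ { (() , _) })

  CountIs-singleton : (x : A) → CountIs (x ≡_) 1
  CountIs-singleton x = (λ _ → x) , (λ { zero zero _ → refl }) , λ y → mk⇔ (λ e → zero , e) proj₂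

  CountIs-⊎ : ∀ {P Q R : A → Set} {M N} → (∀ x → P x → Q x → ⊥) → (∀ x → R x ⇔ (P x ⊎ Q x)) →
    CountIs P M → CountIs Q N → CountIs R (M ℕ.+ N)
  CountIs-⊎ {P} {Q} {R} {M} {N} disj eq (f , finj , fsur) (g , ginj , gsur) =
    h , h-inj , λ x → mk⇔ (λ r → onto x (to (eq x) r)) (λ { (i , refl) → from (eq (h i)) (hit (splitAt M i)) })
    where
    h′ : Fin M ⊎ Fin N → A
    h′ = [ f , g ]′
    h : Fin (M ℕ.+ N) → A
    h i = h′ (splitAt M i)
    fP : ∀ i → P (f i)
    fP i = from (fsur (f i)) (i , refl)
    gQ : ∀ i → Q (g i)
    gQ i = from (gsur (g i)) (i , refl)
    hit : ∀ s → P (h′ s) ⊎ Q (h′ s)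
    hit (inj₁ i) = inj₁ (fP i)
    hit (inj₂ i) = inj₂ (gQ i)
    h′-inj : ∀ s s′ → h′ s ≡ h′ s′ → s ≡ s′
    h′-inj (inj₁ i) (inj₁ j) e = cong inj₁ (finj i j e)
    h′-inj (inj₁ i) (inj₂ j) e = ⊥-elim (disj _ (fP i) (subst Q (sym e) (gQ j)))
    h′-inj (inj₂ i) (inj₁ j) e = ⊥-elim (disj _ (fP j) (subst Q e (gQ i)))
    h′-inj (inj₂ i) (inj₂ j) e = cong inj₂ (ginj i j e)
    h-inj : ∀ i j → h i ≡ h j → i ≡ j
    h-inj i j e = trans (sym (Finₚ.join-splitAt M N i))
      (trans (cong (Fin.join M N) (h′-inj (splitAt M i) (splitAt M j) e)) (Finₚ.join-splitAt M N j))
    onto : ∀ x → P x ⊎ Q x → ∃[ i ] h i ≡ x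
    onto x (inj₁ p) with to (fsur x) p
    ... | i , e = i ↑ˡ N , trans (cong h′ (Finₚ.splitAt-↑ˡ M i N)) e
    onto x (inj₂ q) with to (gsur x) q
    ... | i , e = M ↑ʳ i , trans (cong h′ (Finₚ.splitAt-↑ʳ M N i)) e

  CountIs-Σ : ∀ {k} {R : A → Set} (Q : Fin k → A → Set) (N : Fin k → ℕ) →
    (∀ i j x → Q i x → Q j x → i ≡ j) → (∀ x → R x ⇔ (∃[ i ] Q i x)) →
    (∀ i → CountIs (Q i) (N i)) → CountIs R (sumℕ N)
  CountIs-Σ {zero} Q N disj eq c = CountIs-empty (λ x r → absurd (to (eq x) r))
    where
    absurd : ∀ {x} → ¬ (∃[ i ] Q i x)
    absurd (() , _)
  CountIs-Σ {suc k} {R} Q N disj eq c = CountIs-⊎ {Q = λ x → ∃[ i ] Q (suc i) x}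
    (λ x q → λ { (i , q′) → Finₚ.0≢1+n (disj zero (suc i) x q q′) })
    (λ x → mk⇔ (λ r → split (to (eq x) r)) λ { (inj₁ q) → from (eq x) (zero , q) ; (inj₂ (i , q)) → from (eq x) (suc i , q) })
    (c zero)
    (CountIs-Σ (Q ∘ suc) (N ∘ suc) (λ i j x q q′ → Finₚ.suc-injective (disj _ _ x q q′)) (λ x → mk⇔ (λ r → r) (λ r → r)) (c ∘ suc))
    where
    split : ∀ {x} → ∃[ i ] Q i x → Q zero x ⊎ (∃[ i ] Q (suc i) x)
    split (zero , q) = inj₁ q
    split (suc i , q) = inj₂ (i , q)

CountIs-map : ∀ {A B : Set} {P : A → Set} {Q : B → Set} {N} (g : A → B) →
  (∀ a a′ → P a → P a′ → g a ≡ g a′ → a ≡ a′) →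
  (∀ b → Q b ⇔ (∃[ a ] (P a × g a ≡ b))) → CountIs P N → CountIs Q N
CountIs-map {P = P} {Q} g ginj eq (f , finj , fsur) =
  g ∘ f
  , (λ i j e → finj i j (ginj _ _ (fP i) (fP j) e))
  , λ b → mk⇔ (λ q → onto (to (eq b) q)) λ { (i , e) → from (eq b) (f i , fP i , e) }
  where
  fP : ∀ i → P (f i)
  fP i = from (fsur (f i)) (i , refl)
  onto : ∀ {b} → ∃[ a ] (P a × g a ≡ b) → ∃[ i ] g (f i) ≡ b
  onto (a , p , e) with to (fsur a) p
  ... | i , refl = i , e

true≢false : true ≢ false
true≢false ()

CountIs-countTrue : ∀ {k} (b : Fin k → Bool) → CountIs (λ i → b i ≡ true) (countTrue b)
CountIs-countTrue {zero} b = CountIs-empty (λ ())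
CountIs-countTrue {suc k} b = CountIs-⊎ {P = Head} {Q = Tail} disj split (head (b zero) refl)
  (CountIs-map suc (λ _ _ _ _ → Finₚ.suc-injective) (λ i → mk⇔ (λ { (j , e , p) → j , p , sym e }) (λ { (j , p , e) → j , sym e , p }))
    (CountIs-countTrue (b ∘ suc)))
  where
  Head Tail : Fin (suc k) → Set
  Head i = i ≡ zero × b zero ≡ true
  Tail i = ∃[ j ] (i ≡ suc j × b (suc j) ≡ true)
  disj : ∀ x → Head x → Tail x → ⊥
  disj _ (refl , _) (_ , () , _)
  split : ∀ i → b i ≡ true ⇔ (Head i ⊎ Tail i)
  split zero = mk⇔ (λ p → inj₁ (refl , p)) λ { (inj₁ (_ , p)) → p ; (inj₂ (_ , () , _)) }
  split (suc i) = mk⇔ (λ p → inj₂ (i , refl , p)) λ { (inj₂ (_ , refl , p)) → p }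
  head : ∀ c → b zero ≡ c → CountIs Head (if c then 1 else 0)
  head false e = CountIs-empty (λ { x (_ , p) → absurd (trans (sym e) p) })
    where
    absurd : false ≡ true → ⊥
    absurd ()
  head true e = (λ _ → zero) , (λ { zero zero _ → refl }) , λ x → mk⇔ (λ { (p , _) → zero , sym p }) (λ { (_ , p) → sym p , e })

CountIs-dec : ∀ {k} {P : Fin k → Set} (P? : ∀ i → Dec (P i)) → CountIs P (countTrue (λ i → does (P? i)))
CountIs-dec P? = CountIs-⇔ (λ i → dec⇔ (P? i)) (CountIs-countTrue _)
  where
  dec⇔ : {P : Set} (d : Dec P) → does d ≡ true ⇔ P
  dec⇔ (yes p) = mk⇔ (λ _ → p) (λ _ → refl)
  dec⇔ (no np) = mk⇔ (λ ()) (λ p → ⊥-elim (np p))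

-- The indices marked by `p`, together with the extra index `i`, form a disjoint union inside those
-- marked by `b`.
countTrue-< : ∀ {k} (p b : Fin k → Bool) → (∀ i → p i ≡ true → b i ≡ true) →
  ∀ i → b i ≡ true → p i ≡ false → countTrue p ℕ.< countTrue b
countTrue-< {k} p b imp i bi pi = CountIs-≤ {P = P} {Q = λ j → b j ≡ true} (λ { _ (inj₁ q) → imp _ q ; _ (inj₂ refl) → bi })
  (CountIs-⊎ {P = λ j → i ≡ j} (λ { _ refl q → absurd (trans (sym pi) q) }) (λ _ → mk⇔ swap swap)
    (CountIs-singleton i)
    (CountIs-countTrue p)) (CountIs-countTrue b)
  where
  P : Fin k → Set
  P j = (p j ≡ true) ⊎ (i ≡ j)
  swap : ∀ {X Y : Set} → X ⊎ Y → Y ⊎ X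
  swap (inj₁ x) = inj₂ x
  swap (inj₂ y) = inj₁ y
  absurd : false ≡ true → ⊥
  absurd ()

-- Finite sums of natural numbers

bit : Bool → ℕ
bit b = if b then 1 else 0

sumℕ-cong : ∀ {k} {f g : Fin k → ℕ} → (∀ i → f i ≡ g i) → sumℕ f ≡ sumℕ g
sumℕ-cong {zero} e = refl
sumℕ-cong {suc k} e = cong₂ ℕ._+_ (e zero) (sumℕ-cong (e ∘ suc))

sumℕ-0 : ∀ k → sumℕ {k} (λ _ → 0) ≡ 0
sumℕ-0 zero = refl
sumℕ-0 (suc k) = sumℕ-0 k

sumℕ-+ : ∀ {k} (f g : Fin k → ℕ) → sumℕ (λ i → f i ℕ.+ g i) ≡ sumℕ f ℕ.+ sumℕ g
sumℕ-+ {zero} f g = refl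
sumℕ-+ {suc k} f g = trans (cong (f zero ℕ.+ g zero ℕ.+_) (sumℕ-+ (f ∘ suc) (g ∘ suc)))
  (interchange ℕₚ.+-commutativeSemigroup (f zero) (g zero) (sumℕ (f ∘ suc)) (sumℕ (g ∘ suc)))

countTrue≡sumℕ : ∀ {k} (b : Fin k → Bool) → countTrue b ≡ sumℕ (bit ∘ b)
countTrue≡sumℕ {zero} b = refl
countTrue≡sumℕ {suc k} b = cong (bit (b zero) ℕ.+_) (countTrue≡sumℕ (b ∘ suc))

sumℕ-select : ∀ {k} (g : ℕ → ℕ) i → i ℕ.< k → sumℕ {k} (λ j → bit (does (i ℕ.≟ toℕ j)) ℕ.* g (toℕ j)) ≡ g i
sumℕ-select {suc k} g zero p = trans (cong₂ ℕ._+_ (ℕₚ.*-identityˡ (g 0)) (sumℕ-0 k)) (ℕₚ.+-identityʳ _)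
sumℕ-select {suc k} g (suc i) (s≤s p) = sumℕ-select (g ∘ suc) i p

-- Groups a sum over trees by the value of `w`, which turns the tree-by-tree count of lattice points
-- into the form required of the h*-coefficients. The bound by `D` makes sure that no value of `w`
-- is missed.
sumℕ-fibres : ∀ {k D} (w : Fin k → ℕ) (g : ℕ → ℕ) → (∀ j → w j ℕ.< D) →
  sumℕ {D} (λ i → countTrue (λ j → does (w j ℕ.≟ toℕ i)) ℕ.* g (toℕ i)) ≡ sumℕ (g ∘ w)
sumℕ-fibres {zero} {D} w g lt = sumℕ-0 D
sumℕ-fibres {suc k} {D} w g lt =
  trans (sumℕ-cong {D} (λ i → ℕₚ.*-distribʳ-+ (g (toℕ i)) (bit (does (w zero ℕ.≟ toℕ i))) _))
  (trans (sumℕ-+ {D} _ _) (cong₂ ℕ._+_ (sumℕ-select g (w zero) (lt zero)) (sumℕ-fibres (w ∘ suc) g (lt ∘ suc))))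

-- Weak compositions supported on a mask

-- Vectors rather than functions, because `CountIs` compares elements by propositional equality.
-- Entries off the mask are kept and forced to be zero, so that one index set serves all spanning
-- trees.
Composition : ∀ {m} → (Fin m → Bool) → ℕ → Vec ℕ m → Set
Composition b t v = (sumℕ (lookup v) ≡ t) × (∀ e → b e ≡ false → lookup v e ≡ 0)

-- The number of multisets of size `t` with elements of `N` kinds. The last clause separates those
-- that avoid the first kind from those from which one copy of it can be removed.
multichoose : ℕ → ℕ → ℕ
multichoose zero zero = 1
multichoose zero (suc t) = 0
multichoose (suc N) zero = multichoose N zero
multichoose (suc N) (suc t) = multichoose N (suc t) ℕ.+ multichoose (suc N) t

multichoose-zero : ∀ N → multichoose N 0 ≡ 1
multichoose-zero zero = refl
multichoose-zero (suc N) = multichoose-zero N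

-- Stars and bars; the recursion of `multichoose` is Pascal's rule.
multichoose≡C : ∀ d t → multichoose (suc d) t ≡ (t ℕ.+ d) C d
multichoose≡C d zero = trans (multichoose-zero d) (sym (nCn≡1 d))
multichoose≡C zero (suc t) = trans (multichoose≡C zero t) refl
multichoose≡C (suc d) (suc t) = begin
  multichoose (suc d) (suc t) ℕ.+ multichoose (suc (suc d)) t
    ≡⟨ cong₂ ℕ._+_ (multichoose≡C d (suc t)) (multichoose≡C (suc d) t) ⟩
  (suc t ℕ.+ d) C d ℕ.+ (t ℕ.+ suc d) C suc d
    ≡⟨ cong (λ z → z C d ℕ.+ (t ℕ.+ suc d) C suc d) (sym (ℕₚ.+-suc t d)) ⟩
  (t ℕ.+ suc d) C d ℕ.+ (t ℕ.+ suc d) C suc d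
    ≡⟨ nCk+nC[k+1]≡[n+1]C[k+1] (t ℕ.+ suc d) d ⟩
  (suc t ℕ.+ suc d) C suc d ∎
  where open ≡-Reasoning

CountIs-Composition : ∀ {m} (b : Fin m → Bool) t → CountIs (Composition b t) (multichoose (countTrue b) t)
CountIs-Composition {zero} b zero = (λ _ → []) , (λ { zero zero _ → refl }) , λ { [] → mk⇔ (λ _ → zero , refl) (λ _ → refl , λ ()) }
CountIs-Composition {zero} b (suc t) = CountIs-empty λ { [] (() , _) }
CountIs-Composition {suc m} b t = go (b zero) refl t
  where
  Zero : ℕ → Vec ℕ (suc m) → Set
  Zero t v = Composition b t v × Vec.head v ≡ 0
  countZero : ∀ t → CountIs (Zero t) (multichoose (countTrue (b ∘ suc)) t)
  countZero t = CountIs-map (0 ∷_) (λ _ _ _ _ → Vecₚ.∷-injectiveʳ)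
    (λ { (x ∷ v) → mk⇔ (λ { ((s , z) , refl) → v , (s , z ∘ suc) , refl })
                       (λ { (_ , (s , z) , refl) → (s , λ { zero _ → refl ; (suc e) → z e }) , refl }) })
    (CountIs-Composition (b ∘ suc) t)
  -- An inner recursion on `t` with the mask fixed. If the first position is allowed, a positive
  -- first entry can be lowered by one, which leaves a composition of `t` on the same mask; `raise`
  -- undoes this.
  go : ∀ c → b zero ≡ c → ∀ t → CountIs (Composition b t) (multichoose (bit c ℕ.+ countTrue (b ∘ suc)) t)
  go false eq t = CountIs-⇔ (λ { (x ∷ v) → mk⇔ proj₁ (λ { c@(_ , z) → c , z zero eq }) }) (countZero t)
  go true eq zero = CountIs-⇔ (λ { (x ∷ v) → mk⇔ proj₁ (λ { c@(s , _) → c , ℕₚ.m+n≡0⇒m≡0 x s }) }) (countZero zero)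
  go true eq (suc t) = CountIs-⊎ {Q = λ v → Composition b (suc t) v × Vec.head v ≢ 0} (λ { _ (_ , p) (_ , np) → np p })
    (λ { (zero ∷ v) → mk⇔ (λ c → inj₁ (c , refl)) λ { (inj₁ (c , _)) → c ; (inj₂ (c , _)) → c }
       ; (suc x ∷ v) → mk⇔ (λ c → inj₂ (c , λ ())) λ { (inj₁ (c , _)) → c ; (inj₂ (c , _)) → c } })
    (countZero (suc t))
    (CountIs-map raise
      (λ { (x ∷ v) (y ∷ w) _ _ e → cong₂ _∷_ (ℕₚ.suc-injective (Vecₚ.∷-injectiveˡ e)) (Vecₚ.∷-injectiveʳ e) })
      (λ { (zero ∷ v) → mk⇔ (λ { (_ , np) → ⊥-elim (np refl) }) (λ { ((_ ∷ _) , _ , ()) })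
         ; (suc x ∷ v) → mk⇔ (λ { ((s , z) , _) → (x ∷ v) , (ℕₚ.suc-injective s , λ { zero f → ⊥-elim (absurd (trans (sym eq) f)) ; (suc e) f → z (suc e) f }) , refl })
             (λ { ((_ ∷ _) , (s , z) , refl) → (cong suc s , λ { zero f → ⊥-elim (absurd (trans (sym eq) f)) ; (suc e) f → z (suc e) f }) , λ () }) })
      (go true eq t))
    where
    raise : Vec ℕ (suc m) → Vec ℕ (suc m)
    raise (x ∷ v) = suc x ∷ v
    absurd : true ≡ false → ⊥
    absurd ()

-- Rational arithmetic

⟦_⟧ : ℤ → ℚ
⟦ z ⟧ = z ℚ./ 1

private
  -- The fraction already in lowest terms, whose numerator is visible by computation; `z / 1` passes
  -- through a normalisation that is stuck for a variable `z`.
  whole : ℤ → ℚ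
  whole z = mkℚ z 0 (Coprimality.sym (Coprimality.1-coprimeTo _))

  ⟦⟧≡whole : ∀ z → ⟦ z ⟧ ≡ whole z
  ⟦⟧≡whole z = ℚₚ.↥p/↧p≡p (whole z)

⟦⟧-+ : ∀ z w → ⟦ z ℤ.+ w ⟧ ≡ ⟦ z ⟧ + ⟦ w ⟧
⟦⟧-+ z w rewrite ⟦⟧≡whole z | ⟦⟧≡whole w = cong ⟦_⟧ (sym (cong₂ ℤ._+_ (ℤₚ.*-identityʳ z) (ℤₚ.*-identityʳ w)))

⟦⟧-* : ∀ z w → ⟦ z ℤ.* w ⟧ ≡ ⟦ z ⟧ * ⟦ w ⟧
⟦⟧-* z w rewrite ⟦⟧≡whole z | ⟦⟧≡whole w = refl

⟦⟧-injective : ∀ {z w} → ⟦ z ⟧ ≡ ⟦ w ⟧ → z ≡ w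
⟦⟧-injective {z} {w} e = cong ℚ.numerator (trans (sym (⟦⟧≡whole z)) (trans e (⟦⟧≡whole w)))

⟦⟧-mono-≤ : ∀ {z w} → z ℤ.≤ w → ⟦ z ⟧ ℚ.≤ ⟦ w ⟧
⟦⟧-mono-≤ {z} {w} p rewrite ⟦⟧≡whole z | ⟦⟧≡whole w = ℚ.*≤* (ℤₚ.*-monoʳ-≤-nonNeg (ℤ.+ 1) p)

fromℕ : ℕ → ℚ
fromℕ k = ⟦ ℤ.+ k ⟧

fromℕ-mono-≤ : ∀ {a b} → a ℕ.≤ b → fromℕ a ℚ.≤ fromℕ b
fromℕ-mono-≤ p = ⟦⟧-mono-≤ (ℤ.+≤+ p)

fromℕ-+ : ∀ a b → fromℕ (a ℕ.+ b) ≡ fromℕ a + fromℕ b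
fromℕ-+ a b = ⟦⟧-+ (ℤ.+ a) (ℤ.+ b)

fromℕ-* : ∀ a b → fromℕ (a ℕ.* b) ≡ fromℕ a * fromℕ b
fromℕ-* a b = trans (cong ⟦_⟧ (ℤₚ.pos-* a b)) (⟦⟧-* (ℤ.+ a) (ℤ.+ b))

fromℕ-injective : ∀ {a b} → fromℕ a ≡ fromℕ b → a ≡ b
fromℕ-injective e = ℤₚ.+-injective (⟦⟧-injective e)

0≤fromℕ : ∀ a → 0ℚ ℚ.≤ fromℕ a
0≤fromℕ a = fromℕ-mono-≤ {0} {a} z≤n

0<1 : 0ℚ ℚ.< 1ℚ
0<1 = ℚ.*<* (ℤ.+<+ (s≤s z≤n))

IsInteger : ℚ → Set
IsInteger q = ∃[ z ] q ≡ ⟦ z ⟧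

integer-+ : ∀ {p q} → IsInteger p → IsInteger q → IsInteger (p + q)
integer-+ (z , refl) (w , refl) = z ℤ.+ w , sym (⟦⟧-+ z w)

integer-* : ∀ {p q} → IsInteger p → IsInteger q → IsInteger (p * q)
integer-* (z , refl) (w , refl) = z ℤ.* w , sym (⟦⟧-* z w)

integer-neg : ∀ {p} → IsInteger p → IsInteger (- p)
integer-neg {p} i = subst IsInteger (solve 1 (λ p → con (- 1ℚ) :* p := :- p) refl p) (integer-* (ℤ.- (ℤ.+ 1) , refl) i)

integer-minus : ∀ {p q} → IsInteger p → IsInteger q → IsInteger (p - q)
integer-minus i j = integer-+ i (integer-neg j)

+-nonneg : ∀ {p q} → 0ℚ ℚ.≤ p → 0ℚ ℚ.≤ q → 0ℚ ℚ.≤ p + q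
+-nonneg a b = ℚₚ.+-mono-≤ a b

*-nonneg : ∀ {p q} → 0ℚ ℚ.≤ p → 0ℚ ℚ.≤ q → 0ℚ ℚ.≤ p * q
*-nonneg {p} {q} a b = subst (ℚ._≤ p * q) (ℚₚ.*-zeroʳ p) (ℚₚ.*-monoˡ-≤-nonNeg p {{ℚ.nonNegative a}} b)

*-pos : ∀ {p q} → 0ℚ ℚ.< p → 0ℚ ℚ.< q → 0ℚ ℚ.< p * q
*-pos {p} {q} a b = subst (ℚ._< p * q) (ℚₚ.*-zeroʳ p) (ℚₚ.*-monoʳ-<-pos p {{ℚ.positive a}} b)

*-cancel-pos : ∀ {p q} → 0ℚ ℚ.≤ p → 0ℚ ℚ.< p * q → 0ℚ ℚ.< q
*-cancel-pos {p} {q} a b = ℚₚ.*-cancelˡ-<-nonNeg p {{ℚ.nonNegative a}} (subst (ℚ._< p * q) (sym (ℚₚ.*-zeroʳ p)) b)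

0≤q-p⇒p≤q : ∀ {p q} → 0ℚ ℚ.≤ q - p → p ℚ.≤ q
0≤q-p⇒p≤q {p} {q} h = subst₂ ℚ._≤_ (ℚₚ.+-identityʳ p) (solve 2 (λ p q → p :+ (q :- p) := q) refl p q) (ℚₚ.+-monoʳ-≤ p h)

p≤q⇒0≤q-p : ∀ {p q} → p ℚ.≤ q → 0ℚ ℚ.≤ q - p
p≤q⇒0≤q-p {p} {q} h = subst (ℚ._≤ q - p) (ℚₚ.+-inverseʳ p) (ℚₚ.+-monoˡ-≤ (- p) h)

inverse : ∀ {x} → x ≢ 0ℚ → ∃[ y ] y * x ≡ 1ℚ
inverse {x} ne = (ℚ.1/ x) {{ℚ.≢-nonZero ne}} , ℚₚ.*-inverseˡ x {{ℚ.≢-nonZero ne}}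

inverse-pos : ∀ {x} → 0ℚ ℚ.< x → ∃[ y ] (0ℚ ℚ.< y × y * x ≡ 1ℚ)
inverse-pos {x} p with inverse (λ e → ℚₚ.<-irrefl (sym e) p)
... | y , e = y , *-cancel-pos (ℚₚ.<⇒≤ p) (subst (0ℚ ℚ.<_) (trans (sym e) (ℚₚ.*-comm y x)) 0<1) , e

-- Finite sums of rationals

sumℚ-cong : ∀ {k} {f g : Fin k → ℚ} → (∀ i → f i ≡ g i) → sumℚ f ≡ sumℚ g
sumℚ-cong {zero} e = refl
sumℚ-cong {suc k} e = cong₂ _+_ (e zero) (sumℚ-cong (e ∘ suc))

sumℚ-0 : ∀ {k} {f : Fin k → ℚ} → (∀ i → f i ≡ 0ℚ) → sumℚ f ≡ 0ℚ
sumℚ-0 {zero} e = refl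
sumℚ-0 {suc k} e = cong₂ _+_ (e zero) (sumℚ-0 (e ∘ suc))

sumℚ-+ : ∀ {k} (f g : Fin k → ℚ) → sumℚ (λ i → f i + g i) ≡ sumℚ f + sumℚ g
sumℚ-+ {zero} f g = refl
sumℚ-+ {suc k} f g = trans (cong (f zero + g zero +_) (sumℚ-+ (f ∘ suc) (g ∘ suc)))
  (solve 4 (λ a b c d → (a :+ b) :+ (c :+ d) := (a :+ c) :+ (b :+ d)) refl (f zero) (g zero) _ _)

sumℚ-* : ∀ {k} c (f : Fin k → ℚ) → sumℚ (λ i → c * f i) ≡ c * sumℚ f
sumℚ-* {zero} c f = sym (ℚₚ.*-zeroʳ c)
sumℚ-* {suc k} c f = trans (cong (c * f zero +_) (sumℚ-* c (f ∘ suc))) (sym (ℚₚ.*-distribˡ-+ c _ _))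

sumℚ-*ʳ : ∀ {k} (f : Fin k → ℚ) c → sumℚ (λ i → f i * c) ≡ sumℚ f * c
sumℚ-*ʳ f c = trans (sumℚ-cong (λ i → ℚₚ.*-comm (f i) c)) (trans (sumℚ-* c f) (ℚₚ.*-comm c _))

sumℚ-minus : ∀ {k} (f g : Fin k → ℚ) → sumℚ (λ i → f i - g i) ≡ sumℚ f - sumℚ g
sumℚ-minus f g = begin
  sumℚ (λ i → f i - g i)              ≡⟨ sumℚ-cong (λ i → cong (f i +_) (neg (g i))) ⟩
  sumℚ (λ i → f i + (- 1ℚ) * g i)     ≡⟨ sumℚ-+ f _ ⟩
  sumℚ f + sumℚ (λ i → (- 1ℚ) * g i)  ≡⟨ cong (sumℚ f +_) (sumℚ-* (- 1ℚ) g) ⟩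
  sumℚ f + (- 1ℚ) * sumℚ g            ≡⟨ cong (sumℚ f +_) (sym (neg (sumℚ g))) ⟩
  sumℚ f - sumℚ g                     ∎
  where
  open ≡-Reasoning
  neg : ∀ x → - x ≡ (- 1ℚ) * x
  neg = solve 1 (λ x → :- x := con (- 1ℚ) :* x) refl

sumℚ-swap : ∀ {k l} (f : Fin k → Fin l → ℚ) →
  sumℚ (λ i → sumℚ (f i)) ≡ sumℚ (λ j → sumℚ (λ i → f i j))
sumℚ-swap {zero} {l} f = sym (sumℚ-0 {l} (λ _ → refl))
sumℚ-swap {suc k} f = trans (cong (sumℚ (f zero) +_) (sumℚ-swap (f ∘ suc))) (sym (sumℚ-+ (f zero) _))

sumℚ-single : ∀ {k} (f : Fin k → ℚ) i → (∀ j → j ≢ i → f j ≡ 0ℚ) → sumℚ f ≡ f i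
sumℚ-single f zero e = trans (cong (f zero +_) (sumℚ-0 (λ j → e (suc j) (λ ())))) (ℚₚ.+-identityʳ _)
sumℚ-single f (suc i) e = trans (cong₂ _+_ (e zero (λ ())) (sumℚ-single (f ∘ suc) i (λ j ne → e (suc j) (ne ∘ Finₚ.suc-injective))))
  (ℚₚ.+-identityˡ _)

sumℚ-mono : ∀ {k} {f g : Fin k → ℚ} → (∀ i → f i ℚ.≤ g i) → sumℚ f ℚ.≤ sumℚ g
sumℚ-mono {zero} h = ℚₚ.≤-refl
sumℚ-mono {suc k} h = ℚₚ.+-mono-≤ (h zero) (sumℚ-mono (h ∘ suc))

sumℚ-nonneg : ∀ {k} {f : Fin k → ℚ} → (∀ i → 0ℚ ℚ.≤ f i) → 0ℚ ℚ.≤ sumℚ f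
sumℚ-nonneg {k} {f} h = subst (ℚ._≤ sumℚ f) (sumℚ-0 {k} (λ _ → refl)) (sumℚ-mono {k} h)

term≤sumℚ : ∀ {k} {f : Fin k → ℚ} → (∀ i → 0ℚ ℚ.≤ f i) → ∀ i → f i ℚ.≤ sumℚ f
term≤sumℚ {f = f} h zero = subst (ℚ._≤ sumℚ f) (ℚₚ.+-identityʳ _) (ℚₚ.+-monoʳ-≤ (f zero) (sumℚ-nonneg (h ∘ suc)))
term≤sumℚ {f = f} h (suc i) = ℚₚ.≤-trans (term≤sumℚ (h ∘ suc) i)
  (subst (ℚ._≤ sumℚ f) (ℚₚ.+-identityˡ _) (ℚₚ.+-monoˡ-≤ (sumℚ (f ∘ suc)) (h zero)))

sumℚ-const : ∀ k c → sumℚ {k} (λ _ → c) ≡ fromℕ k * c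
sumℚ-const zero c = sym (ℚₚ.*-zeroˡ c)
sumℚ-const (suc k) c = trans (cong (c +_) (sumℚ-const k c))
  (trans (solve 2 (λ c k → c :+ k :* c := (con 1ℚ :+ k) :* c) refl c (fromℕ k)) (cong (_* c) (sym (fromℕ-+ 1 k))))

sumℚ-fromℕ : ∀ {k} (f : Fin k → ℕ) → sumℚ (fromℕ ∘ f) ≡ fromℕ (sumℕ f)
sumℚ-fromℕ {zero} f = refl
sumℚ-fromℕ {suc k} f = trans (cong (fromℕ (f zero) +_) (sumℚ-fromℕ (f ∘ suc))) (sym (fromℕ-+ (f zero) _))

sumℚ-integer : ∀ {k} {f : Fin k → ℚ} → (∀ i → IsInteger (f i)) → IsInteger (sumℚ f)
sumℚ-integer {zero} h = ℤ.+ 0 , refl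
sumℚ-integer {suc k} h = integer-+ (h zero) (sumℚ-integer (h ∘ suc))

-- Gaussian elimination on the first unknown.
homogeneous-solution : ∀ {N M} → N ℕ.< M → (A : Fin N → Fin M → ℚ) →
  Σ[ μ ∈ (Fin M → ℚ) ] ((∃[ i ] μ i ≢ 0ℚ) × (∀ r → sumℚ (λ i → μ i * A r i) ≡ 0ℚ))
homogeneous-solution {N} {suc M} lt A with Finₚ.any? (λ r → ¬? (A r zero ℚₚ.≟ 0ℚ))
-- The first column is zero, so the first unit vector is a solution.
... | no none = e₀ , (zero , λ ()) , λ r → trans (sumℚ-single _ zero (off r))
        (trans (ℚₚ.*-identityˡ _) (decidable-stable (A r zero ℚₚ.≟ 0ℚ) (λ ne → none (r , ne))))
  where
  e₀ : Fin (suc M) → ℚ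
  e₀ zero = 1ℚ
  e₀ (suc _) = 0ℚ
  off : ∀ r j → j ≢ zero → e₀ j * A r j ≡ 0ℚ
  off r zero ne = ⊥-elim (ne refl)
  off r (suc j) _ = ℚₚ.*-zeroˡ (A r (suc j))
homogeneous-solution {suc N} {suc M} (s≤s lt) A | yes (r , ne) = μ , (suc (proj₁ nz) , proj₂ nz) , solves
  where
  open ≡-Reasoning
  inv = proj₁ (inverse ne)
  A′ : Fin N → Fin M → ℚ
  A′ s i = A (punchIn r s) (suc i) - A (punchIn r s) zero * inv * A r (suc i)
  rec = homogeneous-solution lt A′
  ν = proj₁ rec
  nz = proj₁ (proj₂ rec)
  S : Fin (suc N) → ℚ
  S t = sumℚ (λ i → ν i * A t (suc i))
  μ : Fin (suc M) → ℚ
  -- The value that the pivot row `r` forces on the first unknown. In the other rows this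
  -- substitution gives the reduced system `A′`, which `ν` solves.
  μ zero = - (S r * inv)
  μ (suc i) = ν i
  reduced : ∀ s → S (punchIn r s) - A (punchIn r s) zero * inv * S r ≡ 0ℚ
  reduced s = begin
    S t - c * S r
      ≡⟨ cong (λ z → S t - z) (sym (sumℚ-* c (λ i → ν i * A r (suc i)))) ⟩
    S t - sumℚ (λ i → c * (ν i * A r (suc i)))
      ≡⟨ sym (sumℚ-minus (λ i → ν i * A t (suc i)) (λ i → c * (ν i * A r (suc i)))) ⟩
    sumℚ (λ i → ν i * A t (suc i) - c * (ν i * A r (suc i)))
      ≡⟨ sumℚ-cong (λ i → solve 4 (λ n a c b → n :* a :- c :* (n :* b) := n :* (a :- c :* b)) refl (ν i) _ c _) ⟩
    sumℚ (λ i → ν i * A′ s i)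
      ≡⟨ proj₂ (proj₂ rec) s ⟩
    0ℚ ∎
    where
    t = punchIn r s
    c = A t zero * inv
  solves : ∀ t → μ zero * A t zero + S t ≡ 0ℚ
  solves t with r Fin.≟ t
  ... | yes refl = begin
    - (S r * inv) * A r zero + S r    ≡⟨ solve 3 (λ s v a → (:- (s :* v)) :* a :+ s := s :* (con 1ℚ :- v :* a)) refl (S r) inv (A r zero) ⟩
    S r * (1ℚ - inv * A r zero)       ≡⟨ cong (λ z → S r * (1ℚ - z)) (proj₂ (inverse ne)) ⟩
    S r * (1ℚ - 1ℚ)                   ≡⟨ ℚₚ.*-zeroʳ (S r) ⟩
    0ℚ ∎
  ... | no r≢t = begin
    - (S r * inv) * A t zero + S t    ≡⟨ solve 4 (λ s v a x → (:- (s :* v)) :* a :+ x := x :- a :* v :* s) refl (S r) inv (A t zero) (S t) ⟩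
    S t - A t zero * inv * S r        ≡⟨ cong (λ t → S t - A t zero * inv * S r) (sym (Finₚ.punchIn-punchOut r≢t)) ⟩
    S (punchIn r (punchOut r≢t)) - A (punchIn r (punchOut r≢t)) zero * inv * S r ≡⟨ reduced (punchOut r≢t) ⟩
    0ℚ ∎

-- Exponential edge weights

module _ {m : ℕ} (rank : Fin m → ℕ) where

  weight : Fin m → ℚ
  weight f = fromℕ (suc m ℕ.^ rank f)

  weight-pos : ∀ f → 0ℚ ℚ.< weight f
  weight-pos f = ℚₚ.<-≤-trans 0<1 (fromℕ-mono-≤ (ℕₚ.m^n>0 (suc m) (rank f)))

  -- Let `w` be the weight of an edge and `W` that of `top`. All terms `B w b + W` are nonnegative:
  -- away from `top` either `b` vanishes, or `b ≥ -1` and `B w ≤ W`. So their sum `B s + m W` is at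
  -- least the term `B W + W` of `top`, and `B = m + 1` leaves `B s ≥ 2 W > 0`.
  top-dominates : (b : Fin m → ℚ) (top : Fin m) → (∀ f → - 1ℚ ℚ.≤ b f) → b top ≡ 1ℚ →
    (∀ f → f ≢ top → b f ≡ 0ℚ ⊎ rank f ℕ.< rank top) → 0ℚ ℚ.< sumℚ (λ f → weight f * b f)
  top-dominates b top lower one rest = *-cancel-pos (0≤fromℕ (suc m)) B*sum>0
    where
    B = fromℕ (suc m)
    W = weight top
    s = sumℚ (λ f → weight f * b f)
    g : Fin m → ℚ
    g f = B * (weight f * b f) + W
    0≤W = ℚₚ.<⇒≤ (weight-pos top)
    g-top : g top ≡ B * W + W
    g-top = cong (λ z → B * z + W) (trans (cong (W *_) one) (ℚₚ.*-identityʳ W))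
    g≥0 : ∀ f → 0ℚ ℚ.≤ g f
    g≥0 f with f Fin.≟ top
    ... | yes refl = subst (0ℚ ℚ.≤_) (sym g-top) (+-nonneg (*-nonneg (0≤fromℕ (suc m)) 0≤W) 0≤W)
    ... | no ne with rest f ne
    ... | inj₁ z = subst (0ℚ ℚ.≤_) (sym (trans (cong (λ z → B * (weight f * z) + W) z)
            (solve 3 (λ B w W → B :* (w :* con 0ℚ) :+ W := W) refl B (weight f) W))) 0≤W
    ... | inj₂ lt = subst (0ℚ ℚ.≤_)
            (solve 4 (λ B w W b → B :* w :* (b :- con (- 1ℚ)) :+ (W :- B :* w) := B :* (w :* b) :+ W) refl B (weight f) W (b f))
            (+-nonneg (*-nonneg (*-nonneg (0≤fromℕ (suc m)) (ℚₚ.<⇒≤ (weight-pos f))) (p≤q⇒0≤q-p (lower f)))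
              (p≤q⇒0≤q-p (subst (ℚ._≤ W) (fromℕ-* (suc m) (suc m ℕ.^ rank f)) (fromℕ-mono-≤ {suc m ℕ.* suc m ℕ.^ rank f} {suc m ℕ.^ rank top} (ℕₚ.^-monoʳ-≤ (suc m) lt)))))
    sum-g : sumℚ g ≡ B * s + fromℕ m * W
    sum-g = trans (sumℚ-+ (λ f → B * (weight f * b f)) (λ _ → W)) (cong₂ _+_ (sumℚ-* B (λ f → weight f * b f)) (sumℚ-const m W))
    B*sum>0 : 0ℚ ℚ.< B * s
    B*sum>0 = ℚₚ.<-≤-trans (ℚₚ.+-mono-<-≤ (weight-pos top) 0≤W) (0≤q-p⇒p≤q (subst (0ℚ ℚ.≤_) eq (p≤q⇒0≤q-p (term≤sumℚ g≥0 top))))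
      where
      eq : sumℚ g - g top ≡ B * s - (W + W)
      eq = trans (cong₂ _-_ sum-g (trans g-top (cong (λ z → z * W + W) (fromℕ-+ 1 m))))
        (solve 3 (λ x m W → (x :+ m :* W) :- ((con 1ℚ :+ m) :* W :+ W) := x :- (W :+ W)) refl (B * s) (fromℕ m) W)

-- Walks and cycles

module Walks (G : Digraph) where
  open Digraph G

  Reach-trans : ∀ {S u v w} → Reach G S u v → Reach G S v w → Reach G S u w
  Reach-trans r here = r
  Reach-trans r (fwd e s r′) = fwd e s (Reach-trans r r′)
  Reach-trans r (bwd e s r′) = bwd e s (Reach-trans r r′)

  Reach-sym : ∀ {S u v} → Reach G S u v → Reach G S v u
  Reach-sym here = here
  Reach-sym (fwd e s r) = Reach-trans (bwd e s here) (Reach-sym r)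
  Reach-sym (bwd e s r) = Reach-trans (fwd e s here) (Reach-sym r)

  orient : ∀ {A : Set} → Bool → A → A → A × A
  orient b u v = if b then (u , v) else (v , u)

  -- Unlike `Reach`, a walk records its length and the direction of every step, the data from which
  -- a `CycleIn` is built.
  data Walk (S : Fin m → Set) : ℕ → Fin n → Fin n → Set where
    []   : ∀ {u} → Walk S 0 u u
    cons : ∀ {l u v w} e b → S e → edge e ≡ orient b u v → Walk S l v w → Walk S (suc l) u w

  module _ {S : Fin m → Set} where

    vertexAt : ∀ {l u w} → Walk S l u w → Fin (suc l) → Fin n
    vertexAt {u = u} p zero = u
    vertexAt (cons _ _ _ _ p) (suc i) = vertexAt p i

    edgeAt : ∀ {l u w} → Walk S l u w → Fin l → Fin m
    edgeAt (cons e _ _ _ _) zero = e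
    edgeAt (cons _ _ _ _ p) (suc i) = edgeAt p i

    forwardAt : ∀ {l u w} → Walk S l u w → Fin l → Bool
    forwardAt (cons _ b _ _ _) zero = b
    forwardAt (cons _ _ _ _ p) (suc i) = forwardAt p i

    Simple : ∀ {l u w} → Walk S l u w → Set
    Simple [] = ⊤
    Simple {u = u} (cons _ _ _ _ p) = (∀ i → vertexAt p i ≢ u) × Simple p

    vertexAt-last : ∀ {l u w} (p : Walk S l u w) → vertexAt p (Fin.fromℕ l) ≡ w
    vertexAt-last [] = refl
    vertexAt-last (cons _ _ _ _ p) = vertexAt-last p

    edgeAt∈ : ∀ {l u w} (p : Walk S l u w) i → S (edgeAt p i)
    edgeAt∈ (cons _ _ s _ _) zero = s
    edgeAt∈ (cons _ _ _ _ p) (suc i) = edgeAt∈ p i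

    stepAt : ∀ {l u w} (p : Walk S l u w) i →
      edge (edgeAt p i) ≡ orient (forwardAt p i) (vertexAt p (inject₁ i)) (vertexAt p (suc i))
    stepAt (cons _ _ _ eq p) zero = eq
    stepAt (cons _ _ _ _ p) (suc i) = stepAt p i

    vertexAt-injective : ∀ {l u w} (p : Walk S l u w) → Simple p → ∀ i j → vertexAt p i ≡ vertexAt p j → i ≡ j
    vertexAt-injective p _ zero zero _ = refl
    vertexAt-injective (cons _ _ _ _ p) (ne , _) zero (suc j) eq = ⊥-elim (ne j (sym eq))
    vertexAt-injective (cons _ _ _ _ p) (ne , _) (suc i) zero eq = ⊥-elim (ne i eq)
    vertexAt-injective (cons _ _ _ _ p) (_ , s) (suc i) (suc j) eq = cong suc (vertexAt-injective p s i j eq)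

    orient-endpoint : ∀ {A : Set} b b′ {u v x y : A} → orient b u v ≡ orient b′ x y → (x ≡ u) ⊎ (y ≡ u)
    orient-endpoint true true refl = inj₁ refl
    orient-endpoint true false refl = inj₂ refl
    orient-endpoint false true refl = inj₂ refl
    orient-endpoint false false refl = inj₁ refl

    -- If the first edge occurred again, its endpoint `u` would be a vertex of the rest of the walk,
    -- against simplicity.
    edgeAt-injective : ∀ {l u w} (p : Walk S l u w) → Simple p → ∀ i j → edgeAt p i ≡ edgeAt p j → i ≡ j
    edgeAt-injective (cons _ _ _ _ _) _ zero zero _ = refl
    edgeAt-injective (cons _ _ _ _ p) (_ , s) (suc i) (suc j) eq = cong suc (edgeAt-injective p s i j eq)
    edgeAt-injective (cons e b _ st p) (ne , _) zero (suc j) refl =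
      ⊥-elim ([ ne (inject₁ j) , ne (suc j) ]′ (orient-endpoint b (forwardAt p j) (trans (sym st) (stepAt p j))))
    edgeAt-injective (cons e b _ st p) (ne , _) (suc i) zero refl =
      ⊥-elim ([ ne (inject₁ i) , ne (suc i) ]′ (orient-endpoint b (forwardAt p i) (trans (sym st) (stepAt p i))))

    SimpleWalk : Fin n → Fin n → Set
    SimpleWalk u w = ∃[ l ] Σ[ p ∈ Walk S l u w ] Simple p

    suffix : ∀ {l u w} (p : Walk S l u w) → Simple p → ∀ i → SimpleWalk (vertexAt p i) w
    suffix p s zero = _ , p , s
    suffix (cons _ _ _ _ p) (_ , s) (suc i) = suffix p s i

    -- Loop erasure: if the new vertex already occurs, keep only the part of the walk from that occurrence on.
    cons-simple : ∀ {u v w} e b → S e → edge e ≡ orient b u v → SimpleWalk v w → SimpleWalk u w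
    cons-simple {u} e b s eq (_ , p , sp) with Finₚ.any? (λ i → vertexAt p i Fin.≟ u)
    ... | yes (i , refl) = suffix p sp i
    ... | no new = _ , cons e b s eq p , (λ i e → new (i , e)) , sp

    -- The direction is reversed because `Reach` grows at its end and `Walk` at its start.
    simple-walk : ∀ {u v} → Reach G S u v → SimpleWalk v u
    simple-walk here = _ , [] , tt
    simple-walk (fwd e s r) = cons-simple e false s refl (simple-walk r)
    simple-walk (bwd e s r) = cons-simple e true s refl (simple-walk r)

    -- The cycle starts with `e`, traversed forward; for a loop the walk is empty and the cycle has
    -- length 1. This serves two purposes: with `S` a tree without its edge `e` it contradicts
    -- acyclicity, and with `e` a chord it yields the fundamental cycle to which semi-balancedness
    -- applies.
    close : ∀ {S′ : Fin m → Set} e → ¬ S e → S′ e → (∀ {f} → S f → S′ f) →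
      ∀ {l} (p : Walk S l (hd G e) (tl G e)) → Simple p → CycleIn G S′
    close {S′} e e∉S e∈S′ S⊆S′ {l} p sp = record
      { len = suc l
      ; len≥1 = s≤s z≤n
      ; vs = vs
      ; es = es
      ; fw = fw
      ; closed = vertexAt-last p
      ; vs-inj = vs-inj
      ; es-inj = es-inj
      ; es-in = es-in
      ; step = step
      }
      where
      vs : Fin (suc (suc l)) → Fin n
      vs zero = tl G e
      vs (suc i) = vertexAt p i
      es : Fin (suc l) → Fin m
      es zero = e
      es (suc i) = edgeAt p i
      fw : Fin (suc l) → Bool
      fw zero = true
      fw (suc i) = forwardAt p i
      notLast : ∀ (i : Fin l) → vertexAt p (inject₁ i) ≢ tl G e
      notLast i eq = Finₚ.fromℕ≢inject₁ (vertexAt-injective p sp (Fin.fromℕ l) (inject₁ i) (trans (vertexAt-last p) (sym eq)))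
      vs-inj : ∀ i j → vs (inject₁ i) ≡ vs (inject₁ j) → i ≡ j
      vs-inj zero zero _ = refl
      vs-inj zero (suc j) eq = ⊥-elim (notLast j (sym eq))
      vs-inj (suc i) zero eq = ⊥-elim (notLast i eq)
      vs-inj (suc i) (suc j) eq = cong suc (Finₚ.inject₁-injective (vertexAt-injective p sp _ _ eq))
      es-inj : ∀ i j → es i ≡ es j → i ≡ j
      es-inj zero zero _ = refl
      es-inj zero (suc j) eq = ⊥-elim (e∉S (subst S (sym eq) (edgeAt∈ p j)))
      es-inj (suc i) zero eq = ⊥-elim (e∉S (subst S eq (edgeAt∈ p i)))
      es-inj (suc i) (suc j) eq = cong suc (edgeAt-injective p sp i j eq)
      es-in : ∀ i → S′ (es i)
      es-in zero = e∈S′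
      es-in (suc i) = S⊆S′ (edgeAt∈ p i)
      step : ∀ i → edge (es i) ≡ orient (fw i) (vs (inject₁ i)) (vs (suc i))
      step zero = refl
      step (suc i) = stepAt p i

    module Potential (φ : Fin n → ℚ) (φ-step : ∀ e → S e → φ (hd G e) ≡ φ (tl G e) + 1ℚ) where

      potential-walk : ∀ {l u w} (p : Walk S l u w) →
        φ w + fromℕ (countTrue (not ∘ forwardAt p)) ≡ φ u + fromℕ (countTrue (forwardAt p))
      potential-walk [] = refl
      potential-walk (cons e true s eq p) = begin
        φ _ + fromℕ (countTrue (not ∘ forwardAt p))
          ≡⟨ potential-walk p ⟩
        φ _ + fromℕ (countTrue (forwardAt p))
          ≡⟨ cong (_+ fromℕ (countTrue (forwardAt p))) (subst (λ { (x , y) → φ y ≡ φ x + 1ℚ }) eq (φ-step e s)) ⟩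
        φ _ + 1ℚ + fromℕ (countTrue (forwardAt p))
          ≡⟨ ℚₚ.+-assoc (φ _) 1ℚ _ ⟩
        φ _ + (1ℚ + fromℕ (countTrue (forwardAt p)))
          ≡⟨ cong (φ _ +_) (sym (fromℕ-+ 1 (countTrue (forwardAt p)))) ⟩
        φ _ + fromℕ (suc (countTrue (forwardAt p))) ∎
        where open ≡-Reasoning
      potential-walk (cons {u = u} {v} {w} e false s eq p) = begin
        φ w + fromℕ (suc (countTrue (not ∘ forwardAt p)))
          ≡⟨ cong (φ w +_) (fromℕ-+ 1 (countTrue (not ∘ forwardAt p))) ⟩
        φ w + (1ℚ + fromℕ (countTrue (not ∘ forwardAt p)))
          ≡⟨ swap (φ w) (fromℕ (countTrue (not ∘ forwardAt p))) ⟩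
        φ w + fromℕ (countTrue (not ∘ forwardAt p)) + 1ℚ
          ≡⟨ cong (_+ 1ℚ) (potential-walk p) ⟩
        φ v + fromℕ (countTrue (forwardAt p)) + 1ℚ
          ≡⟨ swap′ (φ v) (fromℕ (countTrue (forwardAt p))) ⟩
        φ v + 1ℚ + fromℕ (countTrue (forwardAt p))
          ≡⟨ cong (_+ fromℕ (countTrue (forwardAt p))) (sym (subst (λ { (x , y) → φ y ≡ φ x + 1ℚ }) eq (φ-step e s))) ⟩
        φ u + fromℕ (countTrue (forwardAt p)) ∎
        where
        open ≡-Reasoning
        swap : ∀ a b → a + (1ℚ + b) ≡ a + b + 1ℚ
        swap = solve 2 (λ a b → a :+ (con 1ℚ :+ b) := a :+ b :+ con 1ℚ) refl
        swap′ : ∀ a b → a + b + 1ℚ ≡ a + 1ℚ + b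
        swap′ = solve 2 (λ a b → a :+ b :+ con 1ℚ := a :+ con 1ℚ :+ b) refl

      -- In the fundamental cycle the chord counts as one forward step, so the walk from its head
      -- back to its tail has one more backward step than forward steps, and the potential drops by
      -- one along that walk.
      potential-chord : SemiBalanced G → ∀ e → ¬ S e → Reach G S (tl G e) (hd G e) → φ (hd G e) ≡ φ (tl G e) + 1ℚ
      potential-chord balanced e e∉S r with simple-walk r
      ... | _ , p , sp = ∙-cancelʳ ℚₚ.+-0-group (fromℕ f) (φ (hd G e)) (φ (tl G e) + 1ℚ) (begin
        φ (hd G e) + fromℕ f             ≡⟨ sym (potential-walk p) ⟩
        φ (tl G e) + fromℕ b             ≡⟨ cong (λ k → φ (tl G e) + fromℕ k) (sym (balanced (close e e∉S tt (λ _ → tt) p sp))) ⟩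
        φ (tl G e) + fromℕ (suc f)       ≡⟨ cong (φ (tl G e) +_) (fromℕ-+ 1 f) ⟩
        φ (tl G e) + (1ℚ + fromℕ f)      ≡⟨ sym (ℚₚ.+-assoc (φ (tl G e)) 1ℚ (fromℕ f)) ⟩
        φ (tl G e) + 1ℚ + fromℕ f        ∎)
        where
        open ≡-Reasoning
        f = countTrue (forwardAt p)
        b = countTrue (not ∘ forwardAt p)

-- Coordinates with respect to a spanning tree

𝟙 : ∀ {P : Set} → Dec P → ℚ
𝟙 (yes _) = 1ℚ
𝟙 (no _) = 0ℚ

𝟙-yes : ∀ {P : Set} (d : Dec P) → P → 𝟙 d ≡ 1ℚ
𝟙-yes (yes _) _ = refl
𝟙-yes (no np) p = ⊥-elim (np p)

𝟙-no : ∀ {P : Set} (d : Dec P) → ¬ P → 𝟙 d ≡ 0ℚ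
𝟙-no (yes p) np = ⊥-elim (np p)
𝟙-no (no _) _ = refl

𝟙-cong : ∀ {P Q : Set} (d : Dec P) (d′ : Dec Q) → (P → Q) → (Q → P) → 𝟙 d ≡ 𝟙 d′
𝟙-cong (yes p) d′ f g = sym (𝟙-yes d′ (f p))
𝟙-cong (no np) d′ f g = sym (𝟙-no d′ (np ∘ g))

𝟙-integer : ∀ {P : Set} (d : Dec P) → IsInteger (𝟙 d)
𝟙-integer (yes _) = ℤ.+ 1 , refl
𝟙-integer (no _) = ℤ.+ 0 , refl

module _ (G : Digraph) where
  open Digraph G

  indicator-same : ∀ u → indicator G u u ≡ 1ℚ
  indicator-same u with u Fin.≟ u
  ... | yes _ = refl
  ... | no ne = ⊥-elim (ne refl)

  indicator-diff : ∀ {u v} → u ≢ v → indicator G u v ≡ 0ℚ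
  indicator-diff {u} {v} ne with u Fin.≟ v
  ... | yes e = ⊥-elim (ne e)
  ... | no _ = refl

  indicator-integer : ∀ u v → IsInteger (indicator G u v)
  indicator-integer u v with u Fin.≟ v
  ... | yes _ = ℤ.+ 1 , refl
  ... | no _ = ℤ.+ 0 , refl

  combo-integer : ∀ {c} → (∀ e → IsInteger (c e)) → ∀ v → IsInteger (combo G c v)
  combo-integer ci v = sumℚ-integer (λ e → integer-* (ci e) (integer-minus (indicator-integer (hd G e) v) (indicator-integer (tl G e) v)))

  combo-+ : ∀ c c′ v → combo G (λ e → c e + c′ e) v ≡ combo G c v + combo G c′ v
  combo-+ c c′ v = trans (sumℚ-cong (λ e → ℚₚ.*-distribʳ-+ (rootVec G e v) (c e) (c′ e))) (sumℚ-+ (λ e → c e * rootVec G e v) (λ e → c′ e * rootVec G e v))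

  combo-* : ∀ r c v → combo G (λ e → r * c e) v ≡ r * combo G c v
  combo-* r c v = trans (sumℚ-cong (λ e → ℚₚ.*-assoc r (c e) (rootVec G e v))) (sumℚ-* r (λ e → c e * rootVec G e v))

  combo-cong : ∀ {c c′} → (∀ e → c e ≡ c′ e) → ∀ v → combo G c v ≡ combo G c′ v
  combo-cong eq v = sumℚ-cong (λ e → cong (_* rootVec G e v) (eq e))

  sum-indicator : ∀ (g : Fin n → ℚ) u → sumℚ (λ v → g v * indicator G u v) ≡ g u
  sum-indicator g u = trans (sumℚ-single (λ v → g v * indicator G u v) u
      (λ v ne → trans (cong (g v *_) (indicator-diff (ne ∘ sym))) (ℚₚ.*-zeroʳ (g v))))
    (trans (cong (g u *_) (indicator-same u)) (ℚₚ.*-identityʳ (g u)))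

  pair-rootVec : ∀ (g : Fin n → ℚ) f → sumℚ (λ v → g v * rootVec G f v) ≡ g (hd G f) - g (tl G f)
  pair-rootVec g f = begin
    sumℚ (λ v → g v * (indicator G (hd G f) v - indicator G (tl G f) v))
      ≡⟨ sumℚ-cong (λ v → solve 3 (λ g a b → g :* (a :- b) := g :* a :- g :* b) refl (g v) (indicator G (hd G f) v) (indicator G (tl G f) v)) ⟩
    sumℚ (λ v → g v * indicator G (hd G f) v - g v * indicator G (tl G f) v)
      ≡⟨ sumℚ-minus (λ v → g v * indicator G (hd G f) v) (λ v → g v * indicator G (tl G f) v) ⟩
    sumℚ (λ v → g v * indicator G (hd G f) v) - sumℚ (λ v → g v * indicator G (tl G f) v)
      ≡⟨ cong₂ _-_ (sum-indicator g (hd G f)) (sum-indicator g (tl G f)) ⟩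
    g (hd G f) - g (tl G f) ∎
    where open ≡-Reasoning

  -- An interchange of sums. When `g` indicates a shore, the right-hand side is a tree coordinate;
  -- hence tree coordinates depend on the point alone and not on the coefficients that represent it.
  pair-combination : ∀ {k} (g : Fin n → ℚ) (f : Fin k → Fin m) (μ : Fin k → ℚ) →
    sumℚ (λ v → g v * sumℚ (λ i → μ i * rootVec G (f i) v)) ≡ sumℚ (λ i → μ i * (g (hd G (f i)) - g (tl G (f i))))
  pair-combination g f μ = begin
    sumℚ (λ v → g v * sumℚ (λ i → μ i * R i v))
      ≡⟨ sumℚ-cong (λ v → sym (sumℚ-* (g v) (λ i → μ i * R i v))) ⟩
    sumℚ (λ v → sumℚ (λ i → g v * (μ i * R i v)))
      ≡⟨ sumℚ-swap (λ v i → g v * (μ i * R i v)) ⟩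
    sumℚ (λ i → sumℚ (λ v → g v * (μ i * R i v)))
      ≡⟨ sumℚ-cong (λ i → sumℚ-cong (λ v → solve 3 (λ g c r → g :* (c :* r) := c :* (g :* r)) refl (g v) (μ i) (R i v))) ⟩
    sumℚ (λ i → sumℚ (λ v → μ i * (g v * R i v)))
      ≡⟨ sumℚ-cong (λ i → trans (sumℚ-* (μ i) (λ v → g v * R i v)) (cong (μ i *_) (pair-rootVec g (f i)))) ⟩
    sumℚ (λ i → μ i * (g (hd G (f i)) - g (tl G (f i)))) ∎
    where
    open ≡-Reasoning
    R : _ → Fin n → ℚ
    R i v = rootVec G (f i) v

module SpanningTree (G : Digraph) (T : Fin (Digraph.m G) → Bool) (tree : IsSpanningTree G T) where
  open Digraph G
  open Walks G

  private
    connected = proj₁ tree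
    acyclic = proj₂ tree

  -- Follow a tree path from the head of `e`: a step along `e` arrives at one of its endpoints, and
  -- any other step stays within the current shore. This makes the shores decidable.
  hd-or-tl-shore : ∀ e {v} → Reach G (λ f → _∈E_ G f T) (hd G e) v →
    Reach G (minus G T e) v (hd G e) ⊎ Reach G (minus G T e) v (tl G e)
  hd-or-tl-shore e here = inj₁ here
  hd-or-tl-shore e (fwd f s r) with f Fin.≟ e
  ... | yes refl = inj₁ here
  ... | no ne = Sum.map (Reach-trans (bwd f (s , ne) here)) (Reach-trans (bwd f (s , ne) here)) (hd-or-tl-shore e r)
  hd-or-tl-shore e (bwd f s r) with f Fin.≟ e
  ... | yes refl = inj₂ here
  ... | no ne = Sum.map (Reach-trans (fwd f (s , ne) here)) (Reach-trans (fwd f (s , ne) here)) (hd-or-tl-shore e r)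

  tl∉head-shore : ∀ e → T e ≡ true → ¬ InHeadShore G T e (tl G e)
  tl∉head-shore e e∈T r with simple-walk r
  ... | _ , p , sp = acyclic (close e (λ s → proj₂ s refl) e∈T proj₁ p sp)

  InHeadShore? : ∀ e → T e ≡ true → ∀ v → Dec (InHeadShore G T e v)
  InHeadShore? e e∈T v with hd-or-tl-shore e (connected (hd G e) v)
  ... | inj₁ r = yes r
  ... | inj₂ r = no (λ r′ → tl∉head-shore e e∈T (Reach-trans (Reach-sym r) r′))

  inTree? : ∀ e → Dec (T e ≡ true)
  inTree? e = T e Boolₚ.≟ true

  abstract
    -- Membership of `e` in the tree is part of the condition, so that `shore` and `coef` vanish for
    -- non-tree edges and sums over the tree can be taken over all edges.
    shore? : ∀ e v → Dec (T e ≡ true × InHeadShore G T e v)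
    shore? e v with inTree? e
    ... | no e∉T = no (e∉T ∘ proj₁)
    ... | yes e∈T = map′ (e∈T ,_) proj₂ (InHeadShore? e e∈T v)

  shore : Fin m → Fin n → ℚ
  shore e v = 𝟙 (shore? e v)

  -- The coefficient of the tree edge e in the expansion of the root vector of f: 1 for f parallel to e in the
  -- fundamental cut of e, −1 for f opposite to e, and 0 outside the cut (or when e is not a tree edge).
  coef : Fin m → Fin m → ℚ
  coef e f = shore e (hd G f) - shore e (tl G f)

  shore-off : ∀ e v → T e ≢ true → shore e v ≡ 0ℚ
  shore-off e v e∉T = 𝟙-no (shore? e v) (e∉T ∘ proj₁)

  coef-off : ∀ e f → T e ≢ true → coef e f ≡ 0ℚ
  coef-off e f e∉T = cong₂ _-_ (shore-off e (hd G f) e∉T) (shore-off e (tl G f) e∉T)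

  data CutView (e f : Fin m) : Set where
    parallel : coef e f ≡ 1ℚ → InHeadShore G T e (hd G f) → ¬ InHeadShore G T e (tl G f) → CutView e f
    opposite : coef e f ≡ - 1ℚ → CutOpposite G T e f → CutView e f
    outside  : coef e f ≡ 0ℚ → ¬ InCut G T e f → CutView e f

  cutView : ∀ e → T e ≡ true → ∀ f → CutView e f
  cutView e e∈T f with InHeadShore? e e∈T (hd G f) | InHeadShore? e e∈T (tl G f)
  ... | yes h | no t = parallel (cong₂ _-_ (𝟙-yes (shore? e (hd G f)) (e∈T , h)) (𝟙-no (shore? e (tl G f)) (t ∘ proj₂))) h t
  ... | no h | yes t = opposite (cong₂ _-_ (𝟙-no (shore? e (hd G f)) (h ∘ proj₂)) (𝟙-yes (shore? e (tl G f)) (e∈T , t))) (t , h)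
  ... | yes h | yes t = outside (cong₂ _-_ (𝟙-yes (shore? e (hd G f)) (e∈T , h)) (𝟙-yes (shore? e (tl G f)) (e∈T , t)))
        [ (λ c → proj₂ c h) , (λ c → proj₂ c t) ]′
  ... | no h | no t = outside (cong₂ _-_ (𝟙-no (shore? e (hd G f)) (h ∘ proj₂)) (𝟙-no (shore? e (tl G f)) (t ∘ proj₂)))
        [ (λ c → t (proj₁ c)) , (λ c → h (proj₁ c)) ]′

  coef-self : ∀ e → T e ≡ true → coef e e ≡ 1ℚ
  coef-self e e∈T with cutView e e∈T e
  ... | parallel eq _ _ = eq
  ... | opposite _ (t , _) = ⊥-elim (tl∉head-shore e e∈T t)
  ... | outside _ out = ⊥-elim (out (inj₂ (here , tl∉head-shore e e∈T)))

  -- The tree edge `f` survives the removal of `e` and joins its own endpoints, so both lie in the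
  -- same shore.
  coef-other : ∀ e f → T f ≡ true → e ≢ f → coef e f ≡ 0ℚ
  coef-other e f f∈T e≢f = trans (cong (_- shore e (tl G f))
      (𝟙-cong (shore? e (hd G f)) (shore? e (tl G f))
        (λ { (e∈T , r) → e∈T , Reach-trans (Reach-sym along) r })
        (λ { (e∈T , r) → e∈T , Reach-trans along r })))
    (ℚₚ.+-inverseʳ (shore e (tl G f)))
    where
    along : Reach G (minus G T e) (hd G f) (tl G f)
    along = bwd f (f∈T , e≢f ∘ sym) here

  coef-range : ∀ e f → (- 1ℚ ℚ.≤ coef e f) × (- 1ℚ ℚ.≤ - coef e f)
  coef-range e f with inTree? e
  ... | no e∉T rewrite coef-off e f e∉T = ℚ.*≤* ℤ.-≤+ , ℚ.*≤* ℤ.-≤+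
  ... | yes e∈T with cutView e e∈T f
  ... | parallel eq _ _ rewrite eq = ℚ.*≤* ℤ.-≤+ , ℚ.*≤* (ℤ.-≤- z≤n)
  ... | opposite eq _ rewrite eq = ℚ.*≤* (ℤ.-≤- z≤n) , ℚ.*≤* ℤ.-≤+
  ... | outside eq _ rewrite eq = ℚ.*≤* ℤ.-≤+ , ℚ.*≤* ℤ.-≤+

  sum-coef-tree : ∀ (g : Fin m → ℚ) f → T f ≡ true → sumℚ (λ e → coef e f * g e) ≡ g f
  sum-coef-tree g f f∈T = trans (sumℚ-single (λ e → coef e f * g e) f
      (λ e ne → trans (cong (_* g e) (coef-other e f f∈T ne)) (ℚₚ.*-zeroˡ (g e))))
    (trans (cong (_* g f) (coef-self f f∈T)) (ℚₚ.*-identityˡ (g f)))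

  -- Telescoping: a step along the tree edge `f` changes the shore value of `f` by one and no other,
  -- so it contributes exactly plus or minus the root vector of `f`. A tree path from the tail to
  -- the head of any edge then expands the root vector of that edge.
  expand-path : ∀ {u w} → Reach G (λ f → _∈E_ G f T) u w → ∀ v →
    sumℚ (λ e → (shore e w - shore e u) * rootVec G e v) ≡ indicator G w v - indicator G u v
  expand-path {u} here v = trans
    (sumℚ-0 {f = λ e → (shore e u - shore e u) * rootVec G e v}
      (λ e → solve 2 (λ s r → (s :- s) :* r := con 0ℚ) refl (shore e u) (rootVec G e v)))
    (sym (ℚₚ.+-inverseʳ (indicator G u v)))
  expand-path {u} (fwd f f∈T r) v = begin
    sumℚ (λ e → (shore e (hd G f) - shore e u) * R e)
      ≡⟨ sumℚ-cong (λ e → solve 4 (λ h t u r → (h :- u) :* r := (h :- t) :* r :+ (t :- u) :* r) refl (shore e (hd G f)) (shore e (tl G f)) (shore e u) (R e)) ⟩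
    sumℚ (λ e → coef e f * R e + (shore e (tl G f) - shore e u) * R e)
      ≡⟨ sumℚ-+ (λ e → coef e f * R e) (λ e → (shore e (tl G f) - shore e u) * R e) ⟩
    sumℚ (λ e → coef e f * R e) + sumℚ (λ e → (shore e (tl G f) - shore e u) * R e)
      ≡⟨ cong₂ _+_ (sum-coef-tree R f f∈T) (expand-path r v) ⟩
    (indicator G (hd G f) v - indicator G (tl G f) v) + (indicator G (tl G f) v - indicator G u v)
      ≡⟨ solve 3 (λ h t u → (h :- t) :+ (t :- u) := h :- u) refl (indicator G (hd G f) v) (indicator G (tl G f) v) (indicator G u v) ⟩
    indicator G (hd G f) v - indicator G u v ∎
    where
    open ≡-Reasoning
    R : Fin m → ℚ
    R e = rootVec G e v
  expand-path {u} (bwd f f∈T r) v = begin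
    sumℚ (λ e → (shore e (tl G f) - shore e u) * R e)
      ≡⟨ sumℚ-cong (λ e → solve 4 (λ h t u r → (t :- u) :* r := (h :- u) :* r :- (h :- t) :* r) refl (shore e (hd G f)) (shore e (tl G f)) (shore e u) (R e)) ⟩
    sumℚ (λ e → (shore e (hd G f) - shore e u) * R e - coef e f * R e)
      ≡⟨ sumℚ-minus (λ e → (shore e (hd G f) - shore e u) * R e) (λ e → coef e f * R e) ⟩
    sumℚ (λ e → (shore e (hd G f) - shore e u) * R e) - sumℚ (λ e → coef e f * R e)
      ≡⟨ cong₂ _-_ (expand-path r v) (sum-coef-tree R f f∈T) ⟩
    (indicator G (hd G f) v - indicator G u v) - (indicator G (hd G f) v - indicator G (tl G f) v)
      ≡⟨ solve 3 (λ h t u → (h :- u) :- (h :- t) := t :- u) refl (indicator G (hd G f) v) (indicator G (tl G f) v) (indicator G u v) ⟩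
    indicator G (tl G f) v - indicator G u v ∎
    where
    open ≡-Reasoning
    R : Fin m → ℚ
    R e = rootVec G e v

  -- The coordinates of the point `combo G c` in the basis of root vectors of the tree;
  -- `coords-cong` shows that they depend on this point only.
  coords : (Fin m → ℚ) → Fin m → ℚ
  coords c e = sumℚ (λ f → c f * coef e f)

  -- The edge values `x` are arbitrary because two choices are used: the entries of root vectors, to
  -- expand points, and the constant 1, to compute coefficient sums.
  combination-via-tree : ∀ {k} (f : Fin k → Fin m) (μ : Fin k → ℚ) (x : Fin m → ℚ) →
    sumℚ (λ e → sumℚ (λ i → μ i * coef e (f i)) * x e) ≡ sumℚ (λ i → μ i * sumℚ (λ e → coef e (f i) * x e))
  combination-via-tree f μ x = begin
    sumℚ (λ e → sumℚ (λ i → μ i * coef e (f i)) * x e)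
      ≡⟨ sumℚ-cong (λ e → sym (sumℚ-*ʳ (λ i → μ i * coef e (f i)) (x e))) ⟩
    sumℚ (λ e → sumℚ (λ i → μ i * coef e (f i) * x e))
      ≡⟨ sumℚ-swap (λ e i → μ i * coef e (f i) * x e) ⟩
    sumℚ (λ i → sumℚ (λ e → μ i * coef e (f i) * x e))
      ≡⟨ sumℚ-cong (λ i → trans (sumℚ-cong (λ e → ℚₚ.*-assoc (μ i) (coef e (f i)) (x e))) (sumℚ-* (μ i) (λ e → coef e (f i) * x e))) ⟩
    sumℚ (λ i → μ i * sumℚ (λ e → coef e (f i) * x e)) ∎
    where open ≡-Reasoning

  expand-rootVec : ∀ f v → sumℚ (λ e → coef e f * rootVec G e v) ≡ rootVec G f v
  expand-rootVec f v = expand-path (connected (tl G f) (hd G f)) v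

  combo-coords : ∀ c v → combo G (coords c) v ≡ combo G c v
  combo-coords c v = trans (combination-via-tree (λ f → f) c (λ e → rootVec G e v))
    (sumℚ-cong (λ f → cong (c f *_) (expand-rootVec f v)))

  coords≡pair : ∀ c e → coords c e ≡ sumℚ (λ v → shore e v * combo G c v)
  coords≡pair c e = sym (pair-combination G (shore e) (λ f → f) c)

  coords-cong : ∀ {c c′} → (∀ v → combo G c v ≡ combo G c′ v) → ∀ e → coords c e ≡ coords c′ e
  coords-cong {c} {c′} eq e = trans (coords≡pair c e)
    (trans (sumℚ-cong (λ v → cong (shore e v *_) (eq v))) (sym (coords≡pair c′ e)))

  -- For a tree edge the coordinate is the sum of the entries of the lattice point over the head
  -- shore.
  coords-integer : ∀ {c} → (∀ v → IsInteger (combo G c v)) → ∀ e → IsInteger (coords c e)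
  coords-integer {c} i e = subst IsInteger (sym (coords≡pair c e)) (sumℚ-integer (λ v → integer-* (𝟙-integer (shore? e v)) (i v)))

  coords-off : ∀ c e → T e ≢ true → coords c e ≡ 0ℚ
  coords-off c e e∉T = sumℚ-0 (λ f → trans (cong (c f *_) (coef-off e f e∉T)) (ℚₚ.*-zeroʳ (c f)))

  coords-own : ∀ c → (∀ e → T e ≢ true → c e ≡ 0ℚ) → ∀ e → coords c e ≡ c e
  coords-own c off e with inTree? e
  ... | no e∉T = trans (coords-off c e e∉T) (sym (off e e∉T))
  ... | yes e∈T = trans (sumℚ-single (λ f → c f * coef e f) e vanish) (trans (cong (c e *_) (coef-self e e∈T)) (ℚₚ.*-identityʳ (c e)))
    where
    vanish : ∀ f → f ≢ e → c f * coef e f ≡ 0ℚ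
    vanish f ne with inTree? f
    ... | yes f∈T = trans (cong (c f *_) (coef-other e f f∈T (ne ∘ sym))) (ℚₚ.*-zeroʳ (c f))
    ... | no f∉T = trans (cong (_* coef e f) (off f f∉T)) (ℚₚ.*-zeroˡ (coef e f))

  coords-+ : ∀ c c′ e → coords (λ f → c f + c′ f) e ≡ coords c e + coords c′ e
  coords-+ c c′ e = trans (sumℚ-cong (λ f → ℚₚ.*-distribʳ-+ (coef e f) (c f) (c′ f))) (sumℚ-+ (λ f → c f * coef e f) (λ f → c′ f * coef e f))

  coords-* : ∀ r c e → coords (λ f → r * c f) e ≡ r * coords c e
  coords-* r c e = trans (sumℚ-cong (λ f → ℚₚ.*-assoc r (c f) (coef e f))) (sumℚ-* r (λ f → c f * coef e f))

  module _ (balanced : SemiBalanced G) where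

    -- Counts the tree edges whose head shore contains `v`. It is a potential that rises by one
    -- along each tree edge, and by semi-balancedness along every edge.
    height : Fin n → ℚ
    height v = sumℚ (λ e → shore e v)

    sum-coef : ∀ f → sumℚ (λ e → coef e f) ≡ height (hd G f) - height (tl G f)
    sum-coef f = sumℚ-minus (λ e → shore e (hd G f)) (λ e → shore e (tl G f))

    height-step-tree : ∀ f → T f ≡ true → height (hd G f) ≡ height (tl G f) + 1ℚ
    height-step-tree f f∈T = begin
      height (hd G f)                                        ≡⟨ solve 2 (λ h t → h := t :+ (h :- t)) refl (height (hd G f)) (height (tl G f)) ⟩
      height (tl G f) + (height (hd G f) - height (tl G f))  ≡⟨ cong (height (tl G f) +_) (sym (sum-coef f)) ⟩
      height (tl G f) + sumℚ (λ e → coef e f)                ≡⟨ cong (height (tl G f) +_) (sumℚ-cong (λ e → sym (ℚₚ.*-identityʳ (coef e f)))) ⟩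
      height (tl G f) + sumℚ (λ e → coef e f * 1ℚ)           ≡⟨ cong (height (tl G f) +_) (sum-coef-tree (λ _ → 1ℚ) f f∈T) ⟩
      height (tl G f) + 1ℚ                                   ∎
      where open ≡-Reasoning

    height-step : ∀ f → height (hd G f) ≡ height (tl G f) + 1ℚ
    height-step f with inTree? f
    ... | yes f∈T = height-step-tree f f∈T
    ... | no f∉T = Potential.potential-chord height height-step-tree balanced f f∉T (connected (tl G f) (hd G f))

    sum-coef≡1 : ∀ f → sumℚ (λ e → coef e f) ≡ 1ℚ
    sum-coef≡1 f = trans (sum-coef f) (trans (cong (_- height (tl G f)) (height-step f))
      (solve 1 (λ t → t :+ con 1ℚ :- t := con 1ℚ) refl (height (tl G f))))

    sum-coords : ∀ c → sumℚ (coords c) ≡ sumℚ c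
    sum-coords c = trans (sumℚ-swap (λ e f → c f * coef e f))
      (sumℚ-cong (λ f → trans (sumℚ-* (c f) (λ e → coef e f)) (trans (cong (c f *_) (sum-coef≡1 f)) (ℚₚ.*-identityʳ (c f)))))

-- The half-open dissection

argmax : ∀ {k} {P : Fin k → Set} (P? : ∀ i → Dec (P i)) (key : Fin k → ℕ) →
  (∀ i → ¬ P i) ⊎ (∃[ i ] (P i × (∀ j → P j → key j ℕ.≤ key i)))
argmax {zero} P? key = inj₁ λ ()
argmax {suc k} P? key with P? zero | argmax (P? ∘ suc) (key ∘ suc)
... | no ¬p | inj₁ none = inj₁ λ { zero → ¬p ; (suc i) → none i }
... | no ¬p | inj₂ (i , p , top) = inj₂ (suc i , p , λ { zero q → ⊥-elim (¬p q) ; (suc j) q → top j q })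
... | yes p | inj₁ none = inj₂ (zero , p , λ { zero _ → ℕₚ.≤-refl ; (suc j) q → ⊥-elim (none j q) })
... | yes p | inj₂ (i , q , top) with ℕₚ.≤-total (key zero) (key (suc i))
... | inj₁ le = inj₂ (suc i , q , λ { zero _ → le ; (suc j) r → top j r })
... | inj₂ ge = inj₂ (zero , p , λ { zero _ → ℕₚ.≤-refl ; (suc j) r → ℕₚ.≤-trans (top j r) ge })

∀-lookup⇒≡ : ∀ {A : Set} {k} {v w : Vec A k} → (∀ i → lookup v i ≡ lookup w i) → v ≡ w
∀-lookup⇒≡ {v = v} {w} eq = trans (sym (Vecₚ.tabulate∘lookup v)) (trans (Vecₚ.tabulate-cong eq) (Vecₚ.tabulate∘lookup w))

0<-p⇒p<0 : ∀ {p} → 0ℚ ℚ.< - p → p ℚ.< 0ℚ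
0<-p⇒p<0 {p} h = subst (ℚ._< 0ℚ) (solve 1 (λ p → :- (:- p) := p) refl p) (ℚₚ.neg-antimono-< h)

module HalfOpen (G : Digraph) (balanced : SemiBalanced G)
  (rank : Fin (Digraph.m G) → ℕ) (rank-injective : ∀ e e′ → rank e ≡ rank e′ → e ≡ e′) where
  open Digraph G

  generic : Fin m → ℚ
  generic = weight rank

  total : ℚ
  total = sumℚ generic

  -- The multiplier `M`. All `coef` lie between -1 and 1, so `total` bounds the absolute values of
  -- the coordinates of `generic` in every tree at once.
  scale : ℚ
  scale = 1ℚ + total

  total≥0 : 0ℚ ℚ.≤ total
  total≥0 = sumℚ-nonneg (λ f → ℚₚ.<⇒≤ (weight-pos rank f))

  scale>0 : 0ℚ ℚ.< scale
  scale>0 = ℚₚ.+-mono-<-≤ 0<1 total≥0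

  point : (Fin m → ℕ) → Vec ℤ n
  point c = tabulate (λ v → proj₁ (combo-integer G (λ e → ℤ.+ c e , refl) v))

  point≡combo : ∀ c v → ⟦ lookup (point c) v ⟧ ≡ combo G (fromℕ ∘ c) v
  point≡combo c v = trans (cong ⟦_⟧ (Vecₚ.lookup∘tabulate _ v)) (sym (proj₂ (combo-integer G (λ e → ℤ.+ c e , refl) v)))

  module ForTree (T : Fin m → Bool) (tree : IsSpanningTree G T) where
    open SpanningTree G T tree

    q : Fin m → ℚ
    q = coords generic

    Passive : Fin m → Set
    Passive = InternallySemiPassive G rank T

    InCut? : ∀ e → T e ≡ true → ∀ f → Dec (InCut G T e f)
    InCut? e e∈T f with cutView e e∈T f
    ... | parallel _ h t = yes (inj₂ (h , t))
    ... | opposite _ c = yes (inj₁ c)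
    ... | outside _ out = no out

    -- The cut contains `e`, hence has an edge `top` of maximal rank. `top-dominates` applies to
    -- `coef e` if `top` is parallel to `e`, and to its negative if `top` is opposite.
    passive-sign : ∀ e → T e ≡ true → (Passive e × q e ℚ.< 0ℚ) ⊎ (¬ Passive e × 0ℚ ℚ.< q e)
    passive-sign e e∈T with argmax (InCut? e e∈T) rank
    ... | inj₁ none = ⊥-elim (none e (inj₂ (Reach.here , tl∉head-shore e e∈T)))
    ... | inj₂ (top , in-cut , maximal) = by-view (cutView e e∈T top)
      where
      below : ∀ f → f ≢ top → coef e f ≡ 0ℚ ⊎ rank f ℕ.< rank top
      below f ne with cutView e e∈T f
      ... | outside eq _ = inj₁ eq
      ... | parallel _ h t = inj₂ (ℕₚ.≤∧≢⇒< (maximal f (inj₂ (h , t))) (ne ∘ rank-injective f top))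
      ... | opposite _ c = inj₂ (ℕₚ.≤∧≢⇒< (maximal f (inj₁ c)) (ne ∘ rank-injective f top))
      by-view : CutView e top → (Passive e × q e ℚ.< 0ℚ) ⊎ (¬ Passive e × 0ℚ ℚ.< q e)
      by-view (outside _ out) = ⊥-elim (out in-cut)
      by-view (parallel eq h t) = inj₂ (not-passive , top-dominates rank (coef e) top (λ f → proj₁ (coef-range e f)) eq below)
        where
        not-passive : ¬ Passive e
        -- An edge witnessing passivity would also have maximal rank in the cut, so it would be
        -- `top`, which stands parallel.
        not-passive (_ , e′ , opp , max′) with rank-injective e′ top (ℕₚ.≤-antisym (maximal e′ (inj₁ opp)) (max′ top in-cut))
        ... | refl = t (proj₁ opp)
      by-view (opposite eq c) = inj₁ ((e∈T , top , c , maximal) , 0<-p⇒p<0 (subst (0ℚ ℚ.<_) sum-neg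
        (top-dominates rank (λ f → - coef e f) top (λ f → proj₂ (coef-range e f)) (cong (λ x → - x) eq)
          (λ f ne → Sum.map₁ (cong (λ x → - x)) (below f ne)))))
        where
        sum-neg : sumℚ (λ f → generic f * - coef e f) ≡ - q e
        sum-neg = begin
          sumℚ (λ f → generic f * - coef e f)
            ≡⟨ sumℚ-cong (λ f → solve 2 (λ w c → w :* :- c := con (- 1ℚ) :* (w :* c)) refl (generic f) (coef e f)) ⟩
          sumℚ (λ f → (- 1ℚ) * (generic f * coef e f))
            ≡⟨ sumℚ-* (- 1ℚ) (λ f → generic f * coef e f) ⟩
          (- 1ℚ) * q e
            ≡⟨ solve 1 (λ x → con (- 1ℚ) :* x := :- x) refl (q e) ⟩
          - q e ∎
          where open ≡-Reasoning

    abstract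
      passive? : ∀ e → Dec (Passive e)
      passive? e with inTree? e
      ... | no e∉T = no (e∉T ∘ proj₁)
      ... | yes e∈T = [ yes ∘ proj₁ , no ∘ proj₁ ]′ (passive-sign e e∈T)

    passive : Fin m → Bool
    passive e = does (passive? e)

    passiveCount : ℕ
    passiveCount = countTrue passive

    data EdgeView (e : Fin m) : Set where
      passive-edge : T e ≡ true → passive e ≡ true → q e ℚ.< 0ℚ → EdgeView e
      active-edge  : T e ≡ true → passive e ≡ false → 0ℚ ℚ.< q e → EdgeView e
      non-tree     : T e ≡ false → passive e ≡ false → q e ≡ 0ℚ → EdgeView e

    edgeView : ∀ e → EdgeView e
    edgeView e with inTree? e
    ... | no e∉T = non-tree (Boolₚ.¬-not e∉T) (dec-false (passive? e) (e∉T ∘ proj₁)) (coords-off generic e e∉T)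
    ... | yes e∈T with passive-sign e e∈T
    ... | inj₁ (p , neg) = passive-edge e∈T (dec-true (passive? e) p) neg
    ... | inj₂ (¬p , pos) = active-edge e∈T (dec-false (passive? e) ¬p) pos

    sum-q : sumℚ q ≡ total
    sum-q = sum-coords balanced generic

    -- With `w` the weight and `c` the coefficient of an edge, the terms `w (1 - c)` are nonnegative
    -- and add up to `total - q e`. The lower bound `0<scale+q` uses `w (1 + c)` in the same way.
    q<scale : ∀ e → q e ℚ.< scale
    q<scale e = ℚₚ.≤-<-trans (0≤q-p⇒p≤q (subst (0ℚ ℚ.≤_) difference (sumℚ-nonneg nonneg)))
      (subst (ℚ._< scale) (ℚₚ.+-identityˡ total) (ℚₚ.+-monoˡ-< total 0<1))
      where
      nonneg : ∀ f → 0ℚ ℚ.≤ generic f * (- coef e f - - 1ℚ)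
      nonneg f = *-nonneg (ℚₚ.<⇒≤ (weight-pos rank f)) (p≤q⇒0≤q-p (proj₂ (coef-range e f)))
      difference : sumℚ (λ f → generic f * (- coef e f - - 1ℚ)) ≡ total - q e
      difference = trans (sumℚ-cong (λ f → solve 2 (λ w c → w :* (:- c :- con (- 1ℚ)) := w :- w :* c) refl (generic f) (coef e f)))
        (sumℚ-minus generic (λ f → generic f * coef e f))

    0<scale+q : ∀ e → 0ℚ ℚ.< scale + q e
    0<scale+q e = subst (0ℚ ℚ.<_) (sym (ℚₚ.+-assoc 1ℚ total (q e)))
      (ℚₚ.+-mono-<-≤ 0<1 (subst (0ℚ ℚ.≤_) total+q (sumℚ-nonneg nonneg)))
      where
      nonneg : ∀ f → 0ℚ ℚ.≤ generic f * (coef e f - - 1ℚ)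
      nonneg f = *-nonneg (ℚₚ.<⇒≤ (weight-pos rank f)) (p≤q⇒0≤q-p (proj₁ (coef-range e f)))
      total+q : sumℚ (λ f → generic f * (coef e f - - 1ℚ)) ≡ total + q e
      total+q = trans (sumℚ-cong (λ f → solve 2 (λ w c → w :* (c :- con (- 1ℚ)) := w :+ w :* c) refl (generic f) (coef e f)))
        (sumℚ-+ generic (λ f → generic f * coef e f))

    passive⇒tree : ∀ e → passive e ≡ true → T e ≡ true
    passive⇒tree e p with edgeView e
    ... | passive-edge t _ _ = t
    ... | active-edge t _ _ = t
    ... | non-tree _ ¬p _ = ⊥-elim (true≢false (trans (sym p) ¬p))

    -- The coordinates of the generic vector add up to a positive number, so not all of them are negative.
    passiveCount<treeSize : Fin m → passiveCount ℕ.< countTrue T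
    passiveCount<treeSize e₀ with Finₚ.any? (λ e → inTree? e ×-dec (passive e Boolₚ.≟ false))
    ... | yes (e , e∈T , ¬p) = countTrue-< passive T passive⇒tree e e∈T ¬p
    ... | no none = ⊥-elim (ℚₚ.<-irrefl refl (ℚₚ.<-≤-trans total>0 (subst (ℚ._≤ 0ℚ) sum-q (subst (sumℚ q ℚ.≤_) (sumℚ-0 {m} (λ _ → refl)) (sumℚ-mono q≤0)))))
      where
      total>0 : 0ℚ ℚ.< total
      total>0 = ℚₚ.<-≤-trans (weight-pos rank e₀) (term≤sumℚ (λ f → ℚₚ.<⇒≤ (weight-pos rank f)) e₀)
      q≤0 : ∀ e → q e ℚ.≤ 0ℚ
      q≤0 e with edgeView e
      ... | passive-edge _ _ neg = ℚₚ.<⇒≤ neg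
      ... | active-edge t ¬p _ = ⊥-elim (none (e , t , ¬p))
      ... | non-tree _ _ z = ℚₚ.≤-reflexive z

    -- Number of tree edges and dimension

    private
      enumeration = CountIs-countTrue T
      treeEdge : Fin (countTrue T) → Fin m
      treeEdge = proj₁ enumeration
      treeEdge∈T : ∀ i → T (treeEdge i) ≡ true
      treeEdge∈T i = from (proj₂ (proj₂ enumeration) (treeEdge i)) (i , refl)

    -- Pairing a linear relation with the shore indicator of `f i` isolates `μ i`, since `coef` is
    -- the identity matrix on tree edges.
    tree-independent : ∀ {k} (f : Fin k → Fin m) → (∀ i j → f i ≡ f j → i ≡ j) → (∀ i → T (f i) ≡ true) →
      AffinelyIndependent G f
    tree-independent f f-inj f∈T μ _ dep i = begin
      μ i
        ≡⟨ sym (trans (cong (μ i *_) (coef-self (f i) (f∈T i))) (ℚₚ.*-identityʳ (μ i))) ⟩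
      μ i * coef (f i) (f i)
        ≡⟨ sym (sumℚ-single (λ j → μ j * coef (f i) (f j)) i (λ j ne →
             trans (cong (μ j *_) (coef-other (f i) (f j) (f∈T j) (ne ∘ sym ∘ f-inj i j))) (ℚₚ.*-zeroʳ (μ j)))) ⟩
      sumℚ (λ j → μ j * coef (f i) (f j))
        ≡⟨ sym (pair-combination G (shore (f i)) f μ) ⟩
      sumℚ (λ v → shore (f i) v * sumℚ (λ j → μ j * rootVec G (f j) v))
        ≡⟨ sumℚ-0 (λ v → trans (cong (shore (f i) v *_) (dep v)) (ℚₚ.*-zeroʳ (shore (f i) v))) ⟩
      0ℚ ∎
      where open ≡-Reasoning

    -- With more vectors than tree edges, the columns of tree coordinates satisfy a nontrivial
    -- relation. It carries over to the root vectors, and it is affine because the tree coordinates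
    -- of each root vector add up to 1.
    independent⇒≤treeSize : ∀ {k} (f : Fin k → Fin m) → AffinelyIndependent G f → k ℕ.≤ countTrue T
    independent⇒≤treeSize {k} f indep with k ℕ.≤? countTrue T
    ... | yes le = le
    ... | no ¬le with homogeneous-solution (ℕₚ.≰⇒> ¬le) (λ r i → coef (treeEdge r) (f i))
    ... | μ , (i , μi≢0) , solves = ⊥-elim (μi≢0 (indep μ sum-μ dep i))
      where
      vanish : ∀ e → sumℚ (λ i → μ i * coef e (f i)) ≡ 0ℚ
      vanish e with inTree? e
      ... | no e∉T = sumℚ-0 (λ i → trans (cong (μ i *_) (coef-off e (f i) e∉T)) (ℚₚ.*-zeroʳ (μ i)))
      ... | yes e∈T with to (proj₂ (proj₂ enumeration) e) e∈T
      ... | r , refl = solves r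
      combination : (x : Fin m → ℚ) → sumℚ (λ i → μ i * sumℚ (λ e → coef e (f i) * x e)) ≡ 0ℚ
      combination x = trans (sym (combination-via-tree f μ x))
        (sumℚ-0 (λ e → trans (cong (_* x e) (vanish e)) (ℚₚ.*-zeroˡ (x e))))
      sum-μ : sumℚ μ ≡ 0ℚ
      sum-μ = trans (sumℚ-cong (λ i → sym (trans (cong (μ i *_)
          (trans (sumℚ-cong (λ e → ℚₚ.*-identityʳ (coef e (f i)))) (sum-coef≡1 balanced (f i)))) (ℚₚ.*-identityʳ (μ i)))))
        (combination (λ _ → 1ℚ))
      dep : ∀ v → sumℚ (λ i → μ i * rootVec G (f i) v) ≡ 0ℚ
      dep v = trans (sumℚ-cong (λ i → cong (μ i *_) (sym (expand-rootVec (f i) v)))) (combination (λ e → rootVec G e v))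

    treeSize : ∀ {d} → HasDim G d → countTrue T ≡ suc d
    treeSize {d} ((f , indep) , maximal) = ℕₚ.≤-antisym (ℕₚ.≮⇒≥ too-big) (independent⇒≤treeSize f indep)
      where
      too-big : ¬ (suc (suc d) ℕ.≤ countTrue T)
      too-big le = maximal (λ i → treeEdge (Fin.inject≤ i le)) (tree-independent _
        (λ i j eq → Finₚ.inject≤-injective le le i j (proj₁ (proj₂ enumeration) _ _ eq)) (λ i → treeEdge∈T _))

    -- Lattice points of half-open simplices

    Supported : Vec ℕ m → Set
    Supported u = ∀ e → T e ≡ false → lookup u e ≡ 0

    -- Tree coordinates in the half-open simplex are at least 1 at passive edges. The vector `u` is
    -- what remains after removing these ones, a weak composition of `t - passiveCount` on the tree,
    -- and `lift` puts them back.
    lift : Vec ℕ m → Fin m → ℕ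
    lift u e = lookup u e ℕ.+ bit (passive e)

    -- The lattice points of the t-th dilate of the simplex of T with the facets opposite to the passive edges removed.
    HalfOpenSimplex : ℕ → Vec ℤ n → Set
    HalfOpenSimplex t x = ∃[ u ] ((sumℕ (lookup u) ℕ.+ passiveCount ≡ t × Supported u) × point (lift u) ≡ x)

    lift-off : ∀ u → Supported u → ∀ e → T e ≢ true → fromℕ (lift u e) ≡ 0ℚ
    lift-off u off e e∉T with edgeView e
    ... | passive-edge t _ _ = ⊥-elim (e∉T t)
    ... | active-edge t _ _ = ⊥-elim (e∉T t)
    ... | non-tree f ¬p _ = cong fromℕ (cong₂ ℕ._+_ (off e f) (cong bit ¬p))

    lift-coords : ∀ u → Supported u → ∀ e → coords (fromℕ ∘ lift u) e ≡ fromℕ (lift u e)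
    lift-coords u off = coords-own (fromℕ ∘ lift u) (lift-off u off)

    sum-lift : ∀ u → sumℚ (fromℕ ∘ lift u) ≡ fromℕ (sumℕ (lookup u) ℕ.+ passiveCount)
    sum-lift u = trans (sumℚ-fromℕ (lift u)) (cong fromℕ (trans (sumℕ-+ (lookup u) (bit ∘ passive))
      (cong (sumℕ (lookup u) ℕ.+_) (sym (countTrue≡sumℕ passive)))))

    point-lift-injective : ∀ u u′ → Supported u → Supported u′ → point (lift u) ≡ point (lift u′) → u ≡ u′
    point-lift-injective u u′ off off′ eq = ∀-lookup⇒≡ (λ e → ℕₚ.+-cancelʳ-≡ (bit (passive e)) (lookup u e) (lookup u′ e)
      (fromℕ-injective (trans (sym (lift-coords u off e)) (trans (coords-cong {fromℕ ∘ lift u} {fromℕ ∘ lift u′} same e) (lift-coords u′ off′ e)))))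
      where
      same : ∀ v → combo G (fromℕ ∘ lift u) v ≡ combo G (fromℕ ∘ lift u′) v
      same v = trans (sym (point≡combo (lift u) v)) (trans (cong (λ x → ⟦ lookup x v ⟧) eq) (point≡combo (lift u′) v))

    CountIs-HalfOpenSimplex : ∀ {d} → countTrue T ≡ suc d → passiveCount ℕ.≤ d → ∀ t →
      CountIs (HalfOpenSimplex t) ((t ℕ.+ d ∸ passiveCount) C d)
    CountIs-HalfOpenSimplex {d} size w≤d t = [ small-count , large-count ]′ (ℕₚ.≤-<-connex passiveCount t)
      where
      small-count : passiveCount ℕ.≤ t → CountIs (HalfOpenSimplex t) ((t ℕ.+ d ∸ passiveCount) C d)
      small-count w≤t = subst (CountIs (HalfOpenSimplex t)) count (CountIs-map (point ∘ lift)
            (λ u u′ p p′ → point-lift-injective u u′ (proj₂ p) (proj₂ p′))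
            (λ x → mk⇔
              (λ { (u , (s , off) , eq) → u , (trans (sym (ℕₚ.m+n∸n≡m (sumℕ (lookup u)) passiveCount)) (cong (_∸ passiveCount) s) , off) , eq })
              (λ { (u , (s , off) , eq) → u , (trans (cong (ℕ._+ passiveCount) s) (ℕₚ.m∸n+n≡m w≤t) , off) , eq }))
            (CountIs-Composition T (t ∸ passiveCount)))
        where
          count : multichoose (countTrue T) (t ∸ passiveCount) ≡ (t ℕ.+ d ∸ passiveCount) C d
          count = trans (cong (λ N → multichoose N (t ∸ passiveCount)) size)
            (trans (multichoose≡C d (t ∸ passiveCount)) (cong (_C d) (sym (ℕₚ.+-∸-comm d w≤t))))
      -- No point exists here, and the binomial coefficient is zero because its upper index is below
      -- `d`; `passiveCount ≤ d` keeps the truncated subtraction exact.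
      large-count : t ℕ.< passiveCount → CountIs (HalfOpenSimplex t) ((t ℕ.+ d ∸ passiveCount) C d)
      large-count t<w = subst (CountIs (HalfOpenSimplex t)) (sym (k>n⇒nCk≡0 small))
            (CountIs-empty λ { x (u , (s , _) , _) → ℕₚ.<⇒≱ t<w (subst (passiveCount ℕ.≤_) s (ℕₚ.m≤n+m passiveCount (sumℕ (lookup u)))) })
        where
          small : t ℕ.+ d ∸ passiveCount ℕ.< d
          small = subst₂ ℕ._<_ (sym (ℕₚ.+-∸-assoc t w≤d)) (ℕₚ.m+[n∸m]≡n w≤d) (ℕₚ.+-monoˡ-< (d ∸ passiveCount) t<w)

    HalfOpenSimplex⇒InDilate : ∀ {t x} → HalfOpenSimplex t x → InDilate G t x
    HalfOpenSimplex⇒InDilate (u , (s , _) , refl) = fromℕ ∘ lift u , 0≤fromℕ ∘ lift u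
      , trans (sum-lift u) (cong fromℕ s) , point≡combo (lift u)

    -- Perturbation towards the generic vector

    shifted : Vec ℕ m → Fin m → ℚ
    shifted u e = scale * fromℕ (lift u e) + q e

    -- At an active edge `q e` is already positive. At a passive edge the lifted coordinate is at
    -- least 1, so the value is at least `scale + q e`.
    shifted>0 : ∀ u e → T e ≡ true → 0ℚ ℚ.< shifted u e
    shifted>0 u e e∈T with edgeView e
    ... | non-tree f _ _ = ⊥-elim (true≢false (trans (sym e∈T) f))
    ... | active-edge _ _ pos = ℚₚ.+-mono-≤-< (*-nonneg (ℚₚ.<⇒≤ scale>0) (0≤fromℕ (lift u e))) pos
    ... | passive-edge _ p _ = ℚₚ.<-≤-trans (0<scale+q e) (ℚₚ.+-monoˡ-≤ (q e)
            (subst (ℚ._≤ scale * fromℕ (lift u e)) (ℚₚ.*-identityʳ scale)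
              (ℚₚ.*-monoˡ-≤-nonNeg scale {{ℚ.nonNegative (ℚₚ.<⇒≤ scale>0)}}
                (fromℕ-mono-≤ {1} {lift u e} (subst (λ b → 1 ℕ.≤ lookup u e ℕ.+ bit b) (sym p) (ℕₚ.m≤n+m 1 (lookup u e)))))))

    -- The factor `r` normalises the coefficient sum to 1. The resulting point is given by `r`, `t`
    -- and `x` without reference to the tree, so a lattice point shared by two half-open simplices
    -- would give a common point of two relative interiors.
    shifted-relint : ∀ {t x} r → 0ℚ ℚ.< r → r * (scale * fromℕ t + total) ≡ 1ℚ → HalfOpenSimplex t x →
      InRelInt G (λ e → _∈E_ G e T) (λ v → r * (scale * ⟦ lookup x v ⟧ + combo G generic v))
    shifted-relint {t} {x} r r>0 normal (u , (s , off) , refl) =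
        (λ e → r * shifted u e)
      , (λ e e∈T → *-pos r>0 (shifted>0 u e e∈T))
      , (λ e e∉T → trans (cong₂ (λ a b → r * (scale * a + b)) (lift-off u off e e∉T) (coords-off generic e e∉T))
          (solve 2 (λ r s → r :* (s :* con 0ℚ :+ con 0ℚ) := con 0ℚ) refl r scale))
      , (begin
          sumℚ (λ e → r * shifted u e)
            ≡⟨ sumℚ-* r (shifted u) ⟩
          r * sumℚ (shifted u)
            ≡⟨ cong (r *_) (trans (sumℚ-+ (λ e → scale * fromℕ (lift u e)) q) (cong₂ _+_ (sumℚ-* scale (fromℕ ∘ lift u)) sum-q)) ⟩
          r * (scale * sumℚ (fromℕ ∘ lift u) + total)
            ≡⟨ cong (λ a → r * (scale * a + total)) (trans (sum-lift u) (cong fromℕ s)) ⟩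
          r * (scale * fromℕ t + total)
            ≡⟨ normal ⟩
          1ℚ ∎)
      , λ v → sym (begin
          combo G (λ e → r * shifted u e) v
            ≡⟨ combo-* G r (shifted u) v ⟩
          r * combo G (shifted u) v
            ≡⟨ cong (r *_) (combo-+ G (λ e → scale * fromℕ (lift u e)) q v) ⟩
          r * (combo G (λ e → scale * fromℕ (lift u e)) v + combo G q v)
            ≡⟨ cong₂ (λ a b → r * (a + b)) (trans (combo-* G scale (fromℕ ∘ lift u) v) (cong (scale *_) (sym (point≡combo (lift u) v))))
                 (combo-coords generic v) ⟩
          r * (scale * ⟦ lookup (point (lift u)) v ⟧ + combo G generic v) ∎)
      where open ≡-Reasoning

    -- A negative integer `z` would give at most `q e - scale < 0`, and `z = 0` gives `q e`, which
    -- is negative at a passive edge.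
    coordinate-bound : ∀ e z → 0ℚ ℚ.≤ scale * ⟦ z ⟧ + q e → ∃[ k ] z ≡ ℤ.+ (k ℕ.+ bit (passive e))
    coordinate-bound e (ℤ.-[1+ k ]) h = ⊥-elim (ℚₚ.<-irrefl refl (ℚₚ.≤-<-trans h
      (ℚₚ.≤-<-trans (ℚₚ.+-monoˡ-≤ (q e) (ℚₚ.*-monoˡ-≤-nonNeg scale {{ℚ.nonNegative (ℚₚ.<⇒≤ scale>0)}} (⟦⟧-mono-≤ {ℤ.-[1+ k ]} {ℤ.-[1+ 0 ]} (ℤ.-≤- z≤n))))
        (subst₂ ℚ._<_ (solve 2 (λ s q → q :- s := s :* con (- 1ℚ) :+ q) refl scale (q e)) (ℚₚ.+-inverseʳ scale) (ℚₚ.+-monoˡ-< (- scale) (q<scale e))))))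
    coordinate-bound e (ℤ.+ k) h with edgeView e
    ... | active-edge _ ¬p _ = k , cong ℤ.+_ (sym (trans (cong (λ b → k ℕ.+ bit b) ¬p) (ℕₚ.+-identityʳ k)))
    ... | non-tree _ ¬p _ = k , cong ℤ.+_ (sym (trans (cong (λ b → k ℕ.+ bit b) ¬p) (ℕₚ.+-identityʳ k)))
    coordinate-bound e (ℤ.+ zero) h | passive-edge _ p neg = ⊥-elim (ℚₚ.<-irrefl refl (ℚₚ.≤-<-trans h
      (subst (ℚ._< 0ℚ) (solve 2 (λ s q → q := s :* con 0ℚ :+ q) refl scale (q e)) neg)))
    coordinate-bound e (ℤ.+ suc k) h | passive-edge _ p _ = k , cong ℤ.+_ (sym (trans (cong (λ b → k ℕ.+ bit b) p) (ℕₚ.+-comm k 1)))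

    -- Weak inequalities suffice, and the covering by closed simplices provides just these:
    -- integrality of the tree coordinates sharpens them through `coordinate-bound`.
    perturbed⇒HalfOpenSimplex : ∀ {t x} (c : Fin m → ℚ) → sumℚ c ≡ fromℕ t → (∀ v → ⟦ lookup x v ⟧ ≡ combo G c v) →
      (∀ e → 0ℚ ℚ.≤ scale * coords c e + q e) → HalfOpenSimplex t x
    perturbed⇒HalfOpenSimplex {t} {x} c sum-c x≡ nonneg = u , (size , off) , ∀-lookup⇒≡ same
      where
      open ≡-Reasoning
      integral : ∀ e → IsInteger (coords c e)
      integral = coords-integer {c} (λ v → lookup x v , sym (x≡ v))
      bound : ∀ e → ∃[ k ] proj₁ (integral e) ≡ ℤ.+ (k ℕ.+ bit (passive e))
      bound e = coordinate-bound e (proj₁ (integral e)) (subst (λ a → 0ℚ ℚ.≤ scale * a + q e) (proj₂ (integral e)) (nonneg e))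
      u : Vec ℕ m
      u = tabulate (proj₁ ∘ bound)
      lookup-u : ∀ e → lookup u e ≡ proj₁ (bound e)
      lookup-u = Vecₚ.lookup∘tabulate (proj₁ ∘ bound)
      lift≡coords : ∀ e → fromℕ (lift u e) ≡ coords c e
      lift≡coords e = begin
        fromℕ (lookup u e ℕ.+ bit (passive e))         ≡⟨ cong (λ k → fromℕ (k ℕ.+ bit (passive e))) (lookup-u e) ⟩
        fromℕ (proj₁ (bound e) ℕ.+ bit (passive e))    ≡⟨ cong ⟦_⟧ (sym (proj₂ (bound e))) ⟩
        ⟦ proj₁ (integral e) ⟧                         ≡⟨ sym (proj₂ (integral e)) ⟩
        coords c e                                     ∎
      size : sumℕ (lookup u) ℕ.+ passiveCount ≡ t
      size = fromℕ-injective (begin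
        fromℕ (sumℕ (lookup u) ℕ.+ passiveCount)   ≡⟨ sym (sum-lift u) ⟩
        sumℚ (fromℕ ∘ lift u)                      ≡⟨ sumℚ-cong lift≡coords ⟩
        sumℚ (coords c)                            ≡⟨ sum-coords balanced c ⟩
        sumℚ c                                     ≡⟨ sum-c ⟩
        fromℕ t                                    ∎)
      off : Supported u
      off e e∉T = ℕₚ.m+n≡0⇒m≡0 (lookup u e) (fromℕ-injective (trans (lift≡coords e)
        (coords-off c e (λ e∈T → true≢false (trans (sym e∈T) e∉T)))))
      same : ∀ v → lookup (point (lift u)) v ≡ lookup x v
      same v = ⟦⟧-injective (begin
        ⟦ lookup (point (lift u)) v ⟧   ≡⟨ point≡combo (lift u) v ⟩
        combo G (fromℕ ∘ lift u) v      ≡⟨ combo-cong G lift≡coords v ⟩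
        combo G (coords c) v            ≡⟨ combo-coords c v ⟩
        combo G c v                     ≡⟨ sym (x≡ v) ⟩
        ⟦ lookup x v ⟧                  ∎)

  abstract
    normaliser : ∀ {t} → 1 ℕ.≤ t → ∃[ r ] (0ℚ ℚ.< r × r * (scale * fromℕ t + total) ≡ 1ℚ)
    normaliser {t} 1≤t = inverse-pos (ℚₚ.+-mono-<-≤ (*-pos scale>0 (ℚₚ.<-≤-trans 0<1 (fromℕ-mono-≤ 1≤t))) total≥0)

  -- Lattice points of the dilated root polytope

  module Dissection {k} (𝒯 : Fin k → (Fin m → Bool)) (dissecting : IsDissectingTreeSet G 𝒯) where

    private
      trees = proj₁ dissecting
      disjoint = proj₁ (proj₂ dissecting)
      covering = proj₂ (proj₂ dissecting)

    module At j = ForTree (𝒯 j) (trees j)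

    HalfOpenSimplex-disjoint : ∀ {t} → 1 ℕ.≤ t → ∀ i j x → At.HalfOpenSimplex i t x → At.HalfOpenSimplex j t x → i ≡ j
    HalfOpenSimplex-disjoint 1≤t i j x hi hj = decidable-stable (i Fin.≟ j) (λ i≢j →
      let r , r>0 , normal = normaliser 1≤t in
      disjoint i j i≢j _ (At.shifted-relint i r r>0 normal hi) (At.shifted-relint j r r>0 normal hj))

    InDilate⇒HalfOpenSimplex : ∀ {t} → 1 ℕ.≤ t → ∀ x → InDilate G t x → ∃[ j ] At.HalfOpenSimplex j t x
    InDilate⇒HalfOpenSimplex {t} 1≤t x (c , c≥0 , sum-c , x≡) = in-tree (to (covering (combo G y)) (y , y≥0 , (λ e ¬⊤ → ⊥-elim (¬⊤ tt)) , sum-y , λ _ → refl))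
      where
      open ≡-Reasoning
      r = proj₁ (normaliser 1≤t)
      r>0 = proj₁ (proj₂ (normaliser 1≤t))
      normal = proj₂ (proj₂ (normaliser 1≤t))
      -- Coefficients over all edges of the normalised perturbed point; being nonnegative with sum
      -- 1, they place it in the root polytope, so some tree simplex contains it.
      y : Fin m → ℚ
      y f = r * (scale * c f + generic f)
      y≥0 : ∀ f → 0ℚ ℚ.≤ y f
      y≥0 f = *-nonneg (ℚₚ.<⇒≤ r>0) (+-nonneg (*-nonneg (ℚₚ.<⇒≤ scale>0) (c≥0 f)) (ℚₚ.<⇒≤ (weight-pos rank f)))
      sum-y : sumℚ y ≡ 1ℚ
      sum-y = begin
        sumℚ y                               ≡⟨ sumℚ-* r (λ f → scale * c f + generic f) ⟩
        r * sumℚ (λ f → scale * c f + generic f)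
          ≡⟨ cong (r *_) (trans (sumℚ-+ (λ f → scale * c f) generic) (cong (_+ total) (trans (sumℚ-* scale c) (cong (scale *_) sum-c)))) ⟩
        r * (scale * fromℕ t + total)        ≡⟨ normal ⟩
        1ℚ                                   ∎
      in-tree : ∃[ j ] InRootPolytope G (λ e → _∈E_ G e (𝒯 j)) (combo G y) → ∃[ j ] At.HalfOpenSimplex j t x
      in-tree (j , c′ , c′≥0 , c′-off , _ , y≡) = j , perturbed⇒HalfOpenSimplex c sum-c x≡ nonneg
        where
        open At j
        open SpanningTree G (𝒯 j) (trees j)
        -- Coefficients supported on a tree are unique, so those given by the covering are the tree
        -- coordinates of the perturbed point.
        c′≡ : ∀ e → c′ e ≡ r * (scale * coords c e + q e)
        c′≡ e = begin
          c′ e                                 ≡⟨ sym (coords-own c′ c′-off e) ⟩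
          coords c′ e                          ≡⟨ coords-cong {c′} {y} (λ v → sym (y≡ v)) e ⟩
          coords y e                           ≡⟨ coords-* r (λ f → scale * c f + generic f) e ⟩
          r * coords (λ f → scale * c f + generic f) e
            ≡⟨ cong (r *_) (trans (coords-+ (λ f → scale * c f) generic e) (cong (_+ q e) (coords-* scale c e))) ⟩
          r * (scale * coords c e + q e)       ∎
        nonneg : ∀ e → 0ℚ ℚ.≤ scale * coords c e + q e
        nonneg e = ℚₚ.*-cancelˡ-≤-pos r {{ℚ.positive r>0}} (subst₂ ℚ._≤_ (sym (ℚₚ.*-zeroʳ r)) (c′≡ e) (c′≥0 e))

    passiveCount≤dim : ∀ {d} → HasDim G d → ∀ j → At.passiveCount j ℕ.≤ d
    passiveCount≤dim dim j = ℕₚ.≤-pred (subst (At.passiveCount j ℕ.<_) (At.treeSize j dim)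
      -- The `d + 1` independent edges in `HasDim` include a first one, which serves as the required
      -- edge of the graph.
      (At.passiveCount<treeSize j (proj₁ (proj₁ dim) zero)))

    CountIs-InDilate : ∀ {d} → HasDim G d → ∀ t → 1 ℕ.≤ t →
      CountIs (InDilate G t) (sumℕ (λ j → (t ℕ.+ d ∸ At.passiveCount j) C d))
    CountIs-InDilate {d} dim t 1≤t = CountIs-Σ (λ j → At.HalfOpenSimplex j t) _ (HalfOpenSimplex-disjoint 1≤t)
      (λ x → mk⇔ (InDilate⇒HalfOpenSimplex 1≤t x) (λ { (j , h) → At.HalfOpenSimplex⇒InDilate j h }))
      (λ j → At.CountIs-HalfOpenSimplex j (At.treeSize j dim) (passiveCount≤dim dim j) t)

-- From half-open simplices to the h*-coefficients

theorem1p9 : (G : Digraph) → SemiBalanced G →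
    (k : ℕ) (𝒯 : Fin k → (Fin (Digraph.m G) → Bool)) → IsDissectingTreeSet G 𝒯 →
    (rank : Fin (Digraph.m G) → ℕ) → (∀ e e′ → rank e ≡ rank e′ → e ≡ e′) →
    (d : ℕ) → HasDim G d →
    Σ[ h ∈ (ℕ → ℕ) ] (IsHStar G d h ×
    (∀ i → CountIs (λ j → CountIs (InternallySemiPassive G rank (𝒯 j)) i) (h i)))
theorem1p9 G balanced k 𝒯 dissecting rank rank-injective d dim = h , (vanishing , counting) , fibre
  where
  open HalfOpen G balanced rank rank-injective
  open Dissection 𝒯 dissecting
  w : Fin k → ℕ
  w j = At.passiveCount j
  h : ℕ → ℕ
  h i = countTrue (λ j → does (w j ℕ.≟ i))
  vanishing : ∀ i → d ℕ.< i → h i ≡ 0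
  vanishing i d<i = CountIs-unique (CountIs-dec (λ j → w j ℕ.≟ i))
    (CountIs-empty (λ { j refl → ℕₚ.<-irrefl refl (ℕₚ.<-≤-trans d<i (passiveCount≤dim dim j)) }))
  counting : ∀ t → 1 ℕ.≤ t → CountIs (InDilate G t)
    (sumℕ {suc d} (λ i → h (toℕ i) ℕ.* ((t ℕ.+ d ∸ toℕ i) C d)))
  counting t 1≤t = subst (CountIs (InDilate G t)) (sym (sumℕ-fibres {D = suc d} w (λ i → (t ℕ.+ d ∸ i) C d) (s≤s ∘ passiveCount≤dim dim)))
    (CountIs-InDilate dim t 1≤t)
  -- The number in a `CountIs` statement is unique, so having exactly `i` passive edges amounts to
  -- `w j ≡ i`, which is decidable.
  fibre : ∀ i → CountIs (λ j → CountIs (InternallySemiPassive G rank (𝒯 j)) i) (h i)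
  fibre i = CountIs-⇔ (λ j → mk⇔ (λ { refl → CountIs-dec (At.passive? j) }) (CountIs-unique (CountIs-dec (At.passive? j))))
    (CountIs-dec (λ j → w j ℕ.≟ i))
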